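{- Let $n\ge1$ and let $\pi,\sigma,\tau\in\mathcal{D}_n$. Suppose that there exist $01$-words $u,\sigma',\pi',v$ such that $$\sigma=u\sigma'v\quad\text{and}\quad\pi=u\pi'v.$$ Let $a,b$ be defined by $n-a=|u|_0+|v|_0$ and $n-b=|u|_1+|v|_1$. Then $t_{\sigma,\tau}^\pi=0$ unless $\tau$ is of the form $$\tau=0^{n-a}\,\tau'\,1^{n-b}$$ for a certain word $\tau'$.
   Context: A $01$-word is a finite word on the alphabet $\{0,1\}$; $|u|_0$ and $|u|_1$ denote the numbers of $0$s and $1$s in $u$; juxtaposition is concatenation. $\mathcal{D}_n$ is the set of $01$-words $\sigma=\sigma_1\cdots\sigma_{2n}$ with $n$ zeros and $n$ ones such that each prefix contains at least as many $0$s as $1$s. A word $\pi\in\mathcal D_n$ is identified with the noncrossing perfect matching of $\{1,\dots,2n\}$ obtained by reading $0$ as an opening and $1$ as a closing parenthesis. **The triangle.** $\mathcal{T}^n$ is the graph with vertices $(x,y)\in\mathbb{Z}^2$, $x\ge y\ge 0$, $x+y\le 4n-2$, with all unit horizontal and vertical edges between these vertices, together with $2n$ external (half-)edges: the $i$th one hangs vertically below the vertex $(2i-2,0)$, $i=1,\dots,2n$. The left boundary vertices are $L_i=(i-1,i-1)$ and the right boundary vertices are $R_i=(2n-2+i,2n-i)$, $i=1,\dots,2n$ (so $L_{2n}=R_1$). **TFPL configurations.** For $\sigma,\tau,\pi\in\mathcal{D}_n$, $t_{\sigma,\tau}^\pi$ is the number of subgraphs (edge sets) $f$ of $\mathcal{T}^n$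 such that: - all $2n$ external edges belong to $f$; - every vertex other than the $L_i$ and $R_i$ is incident to exactly two edges of $f$; - for $1\le i\le 2n-1$ the horizontal edge from $L_i$ to its right neighbour is in $f$; for $2\le i\le 2n$ the vertical edge just below $L_i$ is in $f$ if and only if $\sigma_i=0$; - for $2\le i\le 2n$ the horizontal edge from $R_i$ to its left neighbour is in $f$; for $1\le i\le 2n-1$ the vertical edge just below $R_i$ is in $f$ if and only if $\tau_i=1$; - the $n$ vertices $L_i$ with $\sigma_i=1$ are the starting points of $n$ paths of $f$ whose other endpoints are the $n$ vertices $R_j$ with $\tau_j=0$ (the path at the vertex $L_{2n}=R_1$ is reduced to this single vertex), and the external edges $i$ and $j$ are the two ends of the same path of $f$ if and only if $\{i,j\}$ is a pair of the matching $\pi$. Closed paths are allowed. -}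

module Defs where

open import Data.Nat using (ℕ; zero; suc; _+_; _*_; _∸_; _≤_; _<_; z≤n; s≤s)
import Data.Nat.Properties as ℕ
open import Data.Fin using (Fin; toℕ)
open import Data.Fin.Patterns using (0F; 1F)
import Data.Fin.Properties as Fin
open import Data.Vec using (Vec; lookup; toList)
open import Data.List
  using (List; []; _∷_; _++_; map; filter; length; take; upTo; allFin; head; last;
         concatMap; cartesianProduct)
import Data.List.Properties as List
open import Data.List.Membership.Propositional using (_∈_)
open import Data.List.Membership.Propositional.Properties
  using (∈-map⁺; ∈-filter⁺; ∈-concatMap⁺)
import Data.List.Membership.DecPropositional as DecMembership
open import Data.List.Relation.Unary.All as All using (All; []; _∷_; all?)
open import Data.List.Relation.Unary.AllPairs using ([]; _∷_)
open import Data.List.Relation.Unary.Any as Any using (Any; here; there)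
open import Data.List.Relation.Unary.Linked using (Linked; [-]; _∷_; linked?)
open import Data.List.Relation.Unary.Unique.Propositional using (Unique)
import Data.List.Relation.Unary.Unique.DecPropositional as DecUnique
open import Data.Maybe using (just)
import Data.Maybe.Properties as Maybe
open import Data.Product using (_×_; _,_; proj₁; proj₂; ∃; ∃-syntax)
import Data.Product.Properties as Product
open import Data.Sum using (_⊎_; inj₁; inj₂)
open import Function using (_∘_)
open import Function.Bundles using (_⇔_; mk⇔; Equivalence)
open import Relation.Binary.Definitions using (DecidableEquality)
open import Relation.Binary.PropositionalEquality using (_≡_; _≢_; refl; cong; sym)
open import Relation.Nullary
  using (¬_; Dec; yes; no; ¬?; map′; _×-dec_; _⊎-dec_; _→-dec_; contradiction)

-- All families that are indexed by 1, …, 2n in ordinary notation (letters of a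
-- word, the Lᵢ, the Rᵢ, the external edges) are indexed here by Fin (2 * n),
-- starting from 0.

------------------------------------------------------------------------
-- Words

Word : Set
Word = List (Fin 2)

∣_∣₀ ∣_∣₁ : Word → ℕ
∣ w ∣₀ = length (filter (Fin._≟ 0F) w)
∣ w ∣₁ = length (filter (Fin._≟ 1F) w)

record 𝒟 (n : ℕ) : Set where
  field
    letters : Vec (Fin 2) (2 * n)

  word : Word
  word = toList letters

  letter : Fin (2 * n) → Fin 2
  letter = lookup letters

  field
    zeros  : ∣ word ∣₀ ≡ n
    ones   : ∣ word ∣₁ ≡ n
    ballot : ∀ k → ∣ take k word ∣₁ ≤ ∣ take k word ∣₀

open 𝒟 public using (letters; word; letter)

-- The word is read from left to right; k is the current position and the stack
-- holds the positions of the parentheses that are still open, innermost first.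
-- The third clause (a closing parenthesis on an empty stack) is never reached
-- from a word satisfying the ballot condition.
parenthesisPairs : (k : ℕ) (stack : List ℕ) → Word → List (ℕ × ℕ)
parenthesisPairs k stack       []       = []
parenthesisPairs k stack       (0F ∷ w) = parenthesisPairs (suc k) (k ∷ stack) w
parenthesisPairs k []          (1F ∷ w) = parenthesisPairs (suc k) [] w
parenthesisPairs k (i ∷ stack) (1F ∷ w) = (i , k) ∷ parenthesisPairs (suc k) stack w

-- Each pair is listed once, with its opening (smaller) position first.
matching : ∀ {n} → 𝒟 n → List (ℕ × ℕ)
matching π = parenthesisPairs 0 [] (word π)

------------------------------------------------------------------------
-- The triangle

Vertex : Set
Vertex = ℕ × ℕ

-- rightOf v joins v to its right neighbour. below (x , suc y) joins (x , suc y)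
-- to (x , y), and below (x , 0) is a half-edge hanging from (x , 0).
data Edge : Set where
  rightOf below : Vertex → Edge

ends : Edge → List Vertex
ends (rightOf (x , y))   = (x , y) ∷ (suc x , y) ∷ []
ends (below (x , zero))  = (x , zero) ∷ []
ends (below (x , suc y)) = (x , suc y) ∷ (x , y) ∷ []

_≟ⱽ_ : DecidableEquality Vertex
_≟ⱽ_ = Product.≡-dec ℕ._≟_ ℕ._≟_

_≟ᴱ_ : DecidableEquality Edge
rightOf v ≟ᴱ rightOf w = map′ (cong rightOf) (λ { refl → refl }) (v ≟ⱽ w)
rightOf _ ≟ᴱ below _   = no λ ()
below _   ≟ᴱ rightOf _ = no λ ()
below v   ≟ᴱ below w   = map′ (cong below) (λ { refl → refl }) (v ≟ⱽ w)

open DecMembership _≟ⱽ_ using () renaming (_∈?_ to _∈ⱽ?_)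
open DecMembership _≟ᴱ_ using () renaming (_∈?_ to _∈ᴱ?_)
open DecMembership (Product.≡-dec ℕ._≟_ ℕ._≟_) using () renaming (_∈?_ to _∈ᴾ?_)

InTriangle : ℕ → Vertex → Set
InTriangle n (x , y) = y ≤ x × x + y ≤ 4 * n ∸ 2

inTriangle? : ∀ n v → Dec (InTriangle n v)
inTriangle? n (x , y) = y ℕ.≤? x ×-dec x + y ℕ.≤? 4 * n ∸ 2

-- The box only has to be large enough to contain the triangle.
vertices : ℕ → List Vertex
vertices n = filter (inTriangle? n) (cartesianProduct (upTo (4 * n)) (upTo (4 * n)))

-- The vertex from which an external edge hangs.
foot : ∀ {n} → Fin (2 * n) → Vertex
foot i = 2 * toℕ i , 0

external : ∀ {n} → Fin (2 * n) → Edge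
external {n} i = below (foot {n} i)

edges : ℕ → List Edge
edges n =
     filter (λ e → all? (inTriangle? n) (ends e)) (map rightOf (vertices n))
  ++ map below (filter (λ v → 1 ℕ.≤? proj₂ v) (vertices n))
  ++ map (external {n}) (allFin (2 * n))

L : ∀ {n} → Fin (2 * n) → Vertex
L i = toℕ i , toℕ i

R : ∀ {n} → Fin (2 * n) → Vertex
R {n} i = 2 * n ∸ 2 + suc (toℕ i) , 2 * n ∸ suc (toℕ i)

-- Only applied to vertices with a positive first coordinate.
leftOf : Vertex → Edge
leftOf (x , y) = rightOf (x ∸ 1 , y)

OnBoundary : ℕ → Vertex → Set
OnBoundary n v = ∃[ i ] (v ≡ L {n} i ⊎ v ≡ R {n} i)

------------------------------------------------------------------------
-- Subgraphs

-- Since edges n has no repetitions, its sublists represent the edge sets, each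
-- exactly once.
EdgeSet : Set
EdgeSet = List Edge

sublists : ∀ {A : Set} → List A → List (List A)
sublists []       = [] ∷ []
sublists (x ∷ xs) = sublists xs ++ map (x ∷_) (sublists xs)

degree : EdgeSet → Vertex → ℕ
degree f v = length (filter (λ e → v ∈ⱽ? ends e) f)

Joins : Vertex → Vertex → Edge → Set
Joins v w e = ends e ≡ v ∷ w ∷ [] ⊎ ends e ≡ w ∷ v ∷ []

Adjacent : EdgeSet → Vertex → Vertex → Set
Adjacent f v w = Any (Joins v w) f

record IsPath (f : EdgeSet) (v w : Vertex) (vs : List Vertex) : Set where
  field
    starts : head vs ≡ just v
    stops  : last vs ≡ just w
    linked : Linked (Adjacent f) vs
    simple : Unique vs

-- For v ≡ w the path is reduced to a single vertex.
PathBetween : EdgeSet → Vertex → Vertex → Set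
PathBetween f v w = ∃ (IsPath f v w)

-- An edge set of degree two at the feet of two distinct external edges has
-- these edges as the ends of one of its paths exactly when there is a path
-- between the feet.
record IsTFPL {n : ℕ} (σ τ π : 𝒟 n) (f : EdgeSet) : Set where
  field
    externals : ∀ i → external {n} i ∈ f
    inner     : All (λ v → ¬ OnBoundary n v → degree f v ≡ 2) (vertices n)
    L-right   : ∀ i → suc (toℕ i) < 2 * n → rightOf (L {n} i) ∈ f
    L-below   : ∀ i → 0 < toℕ i → below (L {n} i) ∈ f ⇔ letter σ i ≡ 0F
    R-left    : ∀ i → 0 < toℕ i → leftOf (R {n} i) ∈ f
    R-below   : ∀ i → suc (toℕ i) < 2 * n → below (R {n} i) ∈ f ⇔ letter τ i ≡ 1F
    L-paths   : ∀ i → letter σ i ≡ 1F →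
                ∃[ j ] (letter τ j ≡ 0F × PathBetween f (L {n} i) (R {n} j))
    R-paths   : ∀ j → letter τ j ≡ 0F →
                ∃[ i ] (letter σ i ≡ 1F × PathBetween f (L {n} i) (R {n} j))
    pairing   : ∀ i j → toℕ i < toℕ j →
                PathBetween f (foot {n} i) (foot {n} j) ⇔ (toℕ i , toℕ j) ∈ matching π

------------------------------------------------------------------------
-- Decidability, which is needed only for counting

private

  open DecUnique _≟ⱽ_ using (unique?)

  infix 3 _⇔-dec_

  _⇔-dec_ : ∀ {A B : Set} → Dec A → Dec B → Dec (A ⇔ B)
  a? ⇔-dec b? = map′ (λ (f , g) → mk⇔ f g) (λ e → Equivalence.to e , Equivalence.from e)
                     ((a? →-dec b?) ×-dec (b? →-dec a?))

  joins? : ∀ v w e → Dec (Joins v w e)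
  joins? v w e = List.≡-dec _≟ⱽ_ (ends e) (v ∷ w ∷ []) ⊎-dec
                 List.≡-dec _≟ⱽ_ (ends e) (w ∷ v ∷ [])

  adjacent? : ∀ f v w → Dec (Adjacent f v w)
  adjacent? f v w = Any.any? (joins? v w) f

  isPath? : ∀ f v w vs → Dec (IsPath f v w vs)
  isPath? f v w vs =
    map′ (λ (a , b , c , d) → record { starts = a ; stops = b ; linked = c ; simple = d })
         (λ p → let open IsPath p in starts , stops , linked , simple)
         (Maybe.≡-dec _≟ⱽ_ (head vs) (just v) ×-dec
          Maybe.≡-dec _≟ⱽ_ (last vs) (just w) ×-dec
          linked? (adjacent? f) vs ×-dec
          unique? vs)

  touched : EdgeSet → List Vertex
  touched = concatMap ends

  joins⇒end : ∀ {v w} e → Joins v w e → w ∈ ends e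
  joins⇒end e (inj₁ eq) rewrite eq = there (here refl)
  joins⇒end e (inj₂ eq) rewrite eq = here refl

  adjacent⇒touched : ∀ {v w} f → Adjacent f v w → w ∈ touched f
  adjacent⇒touched f = ∈-concatMap⁺ ends ∘ Any.map (λ {e} → joins⇒end e)

  -- All walks from v with at most k steps.
  walks : EdgeSet → ℕ → Vertex → List (List Vertex)
  walks f zero    v = (v ∷ []) ∷ []
  walks f (suc k) v =
    (v ∷ []) ∷ concatMap (λ u → map (v ∷_) (walks f k u))
                         (filter (adjacent? f v) (touched f))

  walks-complete : ∀ f k v us → Linked (Adjacent f) (v ∷ us) → length us ≤ k →
                   (v ∷ us) ∈ walks f k v
  walks-complete f zero    v []       l       p       = here refl
  walks-complete f (suc k) v []       l       p       = here refl
  walks-complete f (suc k) v (u ∷ us) (a ∷ l) (s≤s p) =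
    there (∈-concatMap⁺ (λ u → map (v ∷_) (walks f k u))
      (Any.map (λ { refl → ∈-map⁺ (v ∷_) (walks-complete f k u us l p) })
               (∈-filter⁺ (adjacent? f v) (adjacent⇒touched f a) a)))

  linked⇒touched : ∀ f {v} us → Linked (Adjacent f) (v ∷ us) → All (_∈ touched f) us
  linked⇒touched f []       l       = []
  linked⇒touched f (u ∷ us) (a ∷ l) = adjacent⇒touched f a ∷ linked⇒touched f us l

  unique⇒short : ∀ us vs → Unique us → All (_∈ vs) us → length us ≤ length vs
  unique⇒short []       vs []         []       = z≤n
  unique⇒short (u ∷ us) vs (u∉us ∷ q) (p ∷ ps) = ℕ.≤-<-trans
    (unique⇒short us (filter (λ w → ¬? (u ≟ⱽ w)) vs) q
      (All.zipWith (λ (u≢w , w∈vs) → ∈-filter⁺ (λ w → ¬? (u ≟ⱽ w)) w∈vs u≢w) (u∉us , ps)))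
    (List.filter-notAll (λ w → ¬? (u ≟ⱽ w)) vs (Any.map (λ u≡w u≢w → u≢w u≡w) p))

  path∈walks : ∀ f v w vs → IsPath f v w vs → vs ∈ walks f (length (touched f)) v
  path∈walks f v w []       p with () ← IsPath.starts p
  path∈walks f v w (u ∷ us) p with refl ← IsPath.starts p | _ ∷ q ← IsPath.simple p =
    walks-complete f _ u us linked (unique⇒short us (touched f) q (linked⇒touched f us linked))
    where open IsPath p using (linked)

  pathBetween? : ∀ f v w → Dec (PathBetween f v w)
  pathBetween? f v w =
    map′ Any.satisfied
         (λ (vs , p) → Any.map (λ { refl → p }) (path∈walks f v w vs p))
         (Any.any? (isPath? f v w) (walks f (length (touched f)) v))

  onBoundary? : ∀ n v → Dec (OnBoundary n v)
  onBoundary? n v = Fin.any? (λ i → (v ≟ⱽ L {n} i) ⊎-dec (v ≟ⱽ R {n} i))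

isTFPL? : ∀ {n} (σ τ π : 𝒟 n) f → Dec (IsTFPL σ τ π f)
isTFPL? {n} σ τ π f =
  map′ (λ (a , b , c , d , e , g , h , k , l) → record
         { externals = a ; inner = b ; L-right = c ; L-below = d ; R-left = e
         ; R-below = g ; L-paths = h ; R-paths = k ; pairing = l })
       (λ t → let open IsTFPL t in
         externals , inner , L-right , L-below , R-left , R-below , L-paths , R-paths , pairing)
       ( Fin.all? (λ i → external {n} i ∈ᴱ? f)
   ×-dec all? (λ v → ¬? (onBoundary? n v) →-dec (degree f v ℕ.≟ 2)) (vertices n)
   ×-dec Fin.all? (λ i → (suc (toℕ i) ℕ.<? 2 * n) →-dec (rightOf (L {n} i) ∈ᴱ? f))
   ×-dec Fin.all? (λ i → (0 ℕ.<? toℕ i) →-dec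
           ((below (L {n} i) ∈ᴱ? f) ⇔-dec (letter σ i Fin.≟ 0F)))
   ×-dec Fin.all? (λ i → (0 ℕ.<? toℕ i) →-dec (leftOf (R {n} i) ∈ᴱ? f))
   ×-dec Fin.all? (λ i → (suc (toℕ i) ℕ.<? 2 * n) →-dec
           ((below (R {n} i) ∈ᴱ? f) ⇔-dec (letter τ i Fin.≟ 1F)))
   ×-dec Fin.all? (λ i → (letter σ i Fin.≟ 1F) →-dec Fin.any? (λ j →
           (letter τ j Fin.≟ 0F) ×-dec pathBetween? f (L {n} i) (R {n} j)))
   ×-dec Fin.all? (λ j → (letter τ j Fin.≟ 0F) →-dec Fin.any? (λ i →
           (letter σ i Fin.≟ 1F) ×-dec pathBetween? f (L {n} i) (R {n} j)))
   ×-dec Fin.all? (λ i → Fin.all? (λ j → (toℕ i ℕ.<? toℕ j) →-dec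
           (pathBetween? f (foot {n} i) (foot {n} j) ⇔-dec
            ((toℕ i , toℕ j) ∈ᴾ? matching π)))))

------------------------------------------------------------------------
-- The number of configurations

t : ∀ {n} → 𝒟 n → 𝒟 n → 𝒟 n → ℕ
t {n} σ τ π = length (filter (isTFPL? σ τ π) (sublists (edges n)))

{-# OPTIONS --safe #-}
module Submission where

-- Orient the paths that are not closed: from L to R, and from the smaller to
-- the larger of two matched external edges. Split the weight 2 of an
-- edge as b + r, where b is what goes from even to odd vertices and r what goes
-- back (b = r = 1 on closed paths); π, σ, τ fix the sums of b and of r around
-- each vertex.
--
-- Cut along the lines x + y = const. Summing r over the rows shows that the r
-- weight crossing row k is the difference of the heights of σ and π after k
-- letters. Inside the common prefix and suffix it vanishes, so there r is
-- forced: in the step to a new row, all edges of r go up if the common letter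
-- is 0 and right if it is 1.
--
-- Now read the letters one by one and follow the odd vertices of a row. Near
-- the left boundary those that receive all their b from the previous row
-- persist as an initial segment, near the bottom those with both edges towards
-- the next row persist as a final segment. Each common letter 0 lengthens the
-- former by one, each common letter 1 the latter. On the right boundary the two
-- segments are the letters 0 at the beginning and 1 at the end of τ.

open import Defs
open import Data.Nat using (ℕ; _+_; _∸_; _≤_)
open import Data.Fin.Patterns using (0F; 1F)
open import Data.List using (_++_; replicate)
open import Data.Product using (∃-syntax)
open import Relation.Binary.PropositionalEquality using (_≡_)
open import Relation.Nullary using (¬_)

open import Data.Empty using (⊥)
open import Data.Fin using (Fin; toℕ; fromℕ<)
import Data.Fin.Properties as Fin
open import Data.List
  using (List; []; _∷_; allFin; cartesianProduct; drop; filter; last; length; map; take; upTo)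
import Data.List.Properties as List
import Data.List.Membership.DecPropositional as DecMembership
open import Data.List.Membership.Propositional using (_∈_; _∉_; find)
open import Data.List.Membership.Propositional.Properties
open import Data.List.Relation.Unary.All as All using (All; []; _∷_; all?)
import Data.List.Relation.Unary.All.Properties as All
open import Data.List.Relation.Unary.AllPairs using (AllPairs; []; _∷_)
import Data.List.Relation.Unary.AllPairs.Properties as AllPairs
open import Data.List.Relation.Unary.Any using (here; there)
open import Data.List.Relation.Unary.Linked as Linked using (Linked; _∷_)
open import Data.List.Relation.Unary.Unique.Propositional using (Unique)
import Data.List.Relation.Unary.Unique.Propositional.Properties as Unique
open import Data.Maybe using (just)
open import Data.Nat using (zero; suc; _*_; _<_; z≤n; s≤s)
open import Data.Nat.ListAction using (sum)
open import Data.Nat.Properties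
open import Data.Nat.Solver using (module +-*-Solver)
open import Data.Product using (Σ; _×_; _,_; proj₁; proj₂)
open import Data.Sum using (_⊎_; inj₁; inj₂)
open import Data.Unit using (⊤; tt)
open import Data.Vec using (Vec; []; _∷_; lookup; toList)
import Data.Vec.Properties as Vec
open import Function using (_∘_)
open import Function.Bundles using (_⇔_; Equivalence; mk⇔)
open import Relation.Binary.Definitions using (DecidableEquality)
open import Relation.Binary.PropositionalEquality
open import Relation.Nullary using (Dec; yes; no; contradiction; _×-dec_; _⊎-dec_)

open DecMembership _≟ⱽ_ using () renaming (_∈?_ to _∈ⱽ?_)

-- Connectivity is global, the row argument local; `Ice` is the interface. Of the configuration it
-- keeps inequalities at single vertices, and of the paths only where they start and end. Doubled
-- weights spare any treatment of closed paths: one unit each way obeys the same balance laws as an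
-- orientation, so these paths need never be found.
--
-- The height difference arises because an odd vertex emits two units of `r`, while an even vertex
-- absorbs at most two, and none if a path starts there. The latter happens at a letter 0 of π on
-- the bottom and at a letter 1 of σ on the left. So a common letter, whichever it is, blocks
-- exactly one of the two ends of the new row, and the difference does not change. It vanishes at
-- both ends of the words, since each has n letters of either kind; hence prefix and suffix can be
-- treated alike, whatever stands between them.
--
-- The initial segment is a statement about `b`, the final one about `g`: two units of `r` on an
-- edge leave no room for `b` there, and they also show that the edge is present.

-- Sums along rows

prev : (ℕ → ℕ) → ℕ → ℕ
prev f zero    = 0
prev f (suc k) = f k

-- Runs through `y + z ≡ k` from the foot `y = 0` to the left boundary `z = 0`.
diagSum : (ℕ → ℕ → ℕ) → ℕ → ℕ
diagSum f zero    = f 0 0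
diagSum f (suc k) = f 0 (suc k) + diagSum (λ y → f (suc y)) k

swap-middle : ∀ a b c d → (a + b) + (c + d) ≡ (a + c) + (b + d)
swap-middle = solve 4 (λ a b c d → (a :+ b) :+ (c :+ d) := (a :+ c) :+ (b :+ d)) refl
  where open +-*-Solver

diagSum-+ : ∀ f g k → diagSum (λ y z → f y z + g y z) k ≡ diagSum f k + diagSum g k
diagSum-+ f g zero    = refl
diagSum-+ f g (suc k) = trans
  (cong (f 0 (suc k) + g 0 (suc k) +_) (diagSum-+ (λ y → f (suc y)) (λ y → g (suc y)) k))
  (swap-middle (f 0 (suc k)) _ _ _)

diagSum-last : ∀ f k → diagSum f (suc k) ≡ diagSum (λ y z → f y (suc z)) k + f (suc k) 0
diagSum-last f zero    = refl
diagSum-last f (suc k) = trans (cong (f 0 (2 + k) +_) (diagSum-last (λ y → f (suc y)) k))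
                               (sym (+-assoc (f 0 (2 + k)) _ _))

-- A shift of one coordinate moves the sum to the previous row; the term pushed over the border is
-- 0.
diagSum-prevˡ : ∀ f k → diagSum (λ y z → prev (λ y′ → f y′ z) y) k ≡ prev (diagSum f) k
diagSum-prevˡ f zero    = refl
diagSum-prevˡ f (suc k) = refl

diagSum-prevʳ : ∀ f k → diagSum (λ y z → prev (f y) z) k ≡ prev (diagSum f) k
diagSum-prevʳ f zero    = refl
diagSum-prevʳ f (suc k) = trans (diagSum-last (λ y z → prev (f y) z) k) (+-identityʳ _)

diagSum-≥ : ∀ f c k → (∀ y z → y + z ≡ k → c ≤ f y z) → suc k * c ≤ diagSum f k
diagSum-≥ f c zero    h = ≤-trans (≤-reflexive (+-identityʳ c)) (h 0 0 refl)
diagSum-≥ f c (suc k) h =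
  +-mono-≤ (h 0 (suc k) refl) (diagSum-≥ (λ y → f (suc y)) c k λ y z e → h (suc y) z (cong suc e))

-- The slack `e` is charged to the last term alone; it will account for the letter of σ at the left
-- boundary.
diagSum-≤ : ∀ f c e k → (∀ y z → y + z ≡ k → f y z ≤ c) → f k 0 + e ≤ c →
            diagSum f k + e ≤ suc k * c
diagSum-≤ f c e zero    h l = ≤-trans l (≤-reflexive (sym (+-identityʳ c)))
diagSum-≤ f c e (suc k) h l = ≤-trans (≤-reflexive (+-assoc (f 0 (suc k)) _ e))
  (+-mono-≤ (h 0 (suc k) refl)
            (diagSum-≤ (λ y → f (suc y)) c e k (λ y z q → h (suc y) z (cong suc q)) l))

diagSum-zero : ∀ f k → diagSum f k ≡ 0 → ∀ y z → y + z ≡ k → f y z ≡ 0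
diagSum-zero f zero    s zero    zero    e = s
diagSum-zero f (suc k) s zero    .(suc k) refl = m+n≡0⇒m≡0 _ s
diagSum-zero f (suc k) s (suc y) z       e =
  diagSum-zero (λ y → f (suc y)) k (m+n≡0⇒n≡0 (f 0 (suc k)) s) y z (suc-injective e)

-- Weights and their local inequalities

-- A weight on the edges, where E y z and O y z are the even and odd vertices of
-- the row y + z (defined below):
--   a y z joins E y z to O y z,        c y z joins O y z to E y (z + 1),
--   u y z joins O y z to E (y + 1) z,  d y z joins O (y + 1) z to E y (z + 1).
record Weight : Set where
  field a c d u : ℕ → ℕ → ℕ

oddSum evenSum : Weight → ℕ → ℕ → ℕ
oddSum w y z = a y z + (c y z + (u y z + prev (λ y′ → d y′ z) y))
  where open Weight w
evenSum w y z = a y z + (prev (λ y′ → u y′ z) y + prev (λ z′ → c y z′ + d y z′) z)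
  where open Weight w

is0 is1 : Fin 2 → ℕ
is0 0F = 1
is0 1F = 0
is1 0F = 0
is1 1F = 1

zeros ones : (ℕ → Fin 2) → ℕ → ℕ
zeros f zero    = 0
zeros f (suc m) = is0 (f m) + zeros f m
ones f zero    = 0
ones f (suc m) = is1 (f m) + ones f m

-- g is the multiplicity of an edge in the configuration; g = 0 outside the
-- triangle. The right boundary is the row M = 2n - 1.
record Ice (M : ℕ) (σ τ π : ℕ → Fin 2) : Set where
  field
    g r b : Weight
  module g = Weight g
  module r = Weight r
  module b = Weight b
  field
    g-c≤1   : ∀ y z → g.c y z ≤ 1
    g-u≤1   : ∀ y z → g.u y z ≤ 1
    r-c     : ∀ y z → r.c y z ≤ 2 * g.c y z
    rb-u    : ∀ y z → r.u y z + b.u y z ≤ 2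
    g-odd   : ∀ y z → y + z < M → oddSum g y z ≡ 2
    g-even  : ∀ y z → y + z < M → evenSum g y z ≤ 2
    g-foot  : ∀ z → z < M → evenSum g 0 z ≤ 1
    g-left  : ∀ y → y < M → 1 ≤ g.a y 0
    g-right : ∀ y z → suc (y + z) ≡ M → 1 ≤ g.u y z → τ z ≡ 1F
    r-odd   : ∀ y z → y + z < M → 2 ≤ oddSum r y z
    r-even  : ∀ y z → y + z < M → evenSum r y z ≤ 2
    r-foot  : ∀ z → z < M → π z ≡ 0F → evenSum r 0 z ≡ 0
    r-left  : ∀ y → y < M → σ y ≡ 1F → evenSum r y 0 ≡ 0
    b-odd   : ∀ y z → y + z < M → oddSum b y z ≤ 2
    b-even  : ∀ y z → y + z < M → (y ≡ 0 → π z ≡ 0F) → 2 ≤ evenSum b y z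
    b-right : ∀ y z → suc (suc (y + z)) ≡ M → τ (suc z) ≡ 1F →
              2 ≤ b.u y (suc z) + b.c (suc y) z
    σ-first : σ 0 ≡ 0F
    π-first : π 0 ≡ 0F
    τ-first : τ 0 ≡ 0F
    π-last  : π M ≡ 1F
    τ-last  : τ M ≡ 1F

-- The weight of r in a row

module _ {M σ τ π} (I : Ice M σ τ π) where
  open Ice I

  -- The weight of r between the even and the odd vertices of row k.
  rowWeight : ℕ → ℕ
  rowWeight k = diagSum r.a k + prev (diagSum r.d) k

  oddRow : ∀ k → diagSum (oddSum r) k ≡ rowWeight k + (diagSum r.c k + diagSum r.u k)
  oddRow k = begin
    diagSum (oddSum r) k
      ≡⟨ diagSum-+ r.a _ k ⟩
    A + diagSum (λ y z → r.c y z + (r.u y z + prev (λ y′ → r.d y′ z) y)) k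
      ≡⟨ cong (A +_) (diagSum-+ r.c _ k) ⟩
    A + (C + diagSum (λ y z → r.u y z + prev (λ y′ → r.d y′ z) y) k)
      ≡⟨ cong (λ x → A + (C + x)) (diagSum-+ r.u _ k) ⟩
    A + (C + (U + diagSum (λ y z → prev (λ y′ → r.d y′ z) y) k))
      ≡⟨ cong (λ x → A + (C + (U + x))) (diagSum-prevˡ r.d k) ⟩
    A + (C + (U + D))
      ≡⟨ solve 4 (λ a c u d → a :+ (c :+ (u :+ d)) := (a :+ d) :+ (c :+ u)) refl A C U D ⟩
    A + D + (C + U) ∎
    where
    open ≡-Reasoning
    open +-*-Solver
    A = diagSum r.a k
    C = diagSum r.c k
    U = diagSum r.u k
    D = prev (diagSum r.d) k

  -- The edges `c` and `u` leaving the odd vertices of row k are those entering the even vertices of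
  -- row k + 1, so the last summand is the one of `oddRow` and can be eliminated.
  evenRow : ∀ k → diagSum (evenSum r) (suc k) ≡
                  rowWeight (suc k) + (diagSum r.c k + diagSum r.u k)
  evenRow k = begin
    diagSum (evenSum r) (suc k)
      ≡⟨ diagSum-+ r.a (λ y z → prev (λ y′ → r.u y′ z) y + prev (λ z′ → r.c y z′ + r.d y z′) z)
                   (suc k) ⟩
    A + diagSum (λ y z → prev (λ y′ → r.u y′ z) y + prev (λ z′ → r.c y z′ + r.d y z′) z) (suc k)
      ≡⟨ cong (A +_) (diagSum-+ (λ y z → prev (λ y′ → r.u y′ z) y)
                                (λ y z → prev (λ z′ → r.c y z′ + r.d y z′) z) (suc k)) ⟩
    A + (U + diagSum (λ y z → prev (λ z′ → r.c y z′ + r.d y z′) z) (suc k))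
      ≡⟨ cong (λ x → A + (U + x)) (diagSum-prevʳ (λ y z → r.c y z + r.d y z) (suc k)) ⟩
    A + (U + diagSum (λ y z → r.c y z + r.d y z) k)
      ≡⟨ cong (λ x → A + (U + x)) (diagSum-+ r.c r.d k) ⟩
    A + (U + (C + D))
      ≡⟨ solve 4 (λ a c u d → a :+ (u :+ (c :+ d)) := (a :+ d) :+ (c :+ u)) refl A C U D ⟩
    A + D + (C + U) ∎
    where
    open ≡-Reasoning
    open +-*-Solver
    A = diagSum r.a (suc k)
    C = diagSum r.c k
    U = diagSum r.u k
    D = diagSum r.d k

  foot-bound : ∀ z → z < M → evenSum r 0 z + 2 * is0 (π z) ≤ 2
  foot-bound z z<M with π z in eq
  ... | 0F = ≤-reflexive (cong (_+ 2) (r-foot z z<M eq))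
  ... | 1F = ≤-trans (≤-reflexive (+-identityʳ _)) (r-even 0 z z<M)

  left-bound : ∀ y → y < M → evenSum r y 0 + 2 * is1 (σ y) ≤ 2
  left-bound y y<M with σ y in eq
  ... | 1F = ≤-reflexive (cong (_+ 2) (r-left y y<M eq))
  ... | 0F = ≤-trans (≤-reflexive (+-identityʳ _))
                     (r-even y 0 (subst (_< M) (sym (+-identityʳ y)) y<M))

  -- Row k + 1 has k + 2 even vertices of capacity 2. The foot loses its capacity at a letter 0 of
  -- π, the left boundary vertex at a letter 1 of σ. In row 0 these two vertices coincide, which is
  -- why the bound starts one row later.
  evenRow-bound : ∀ k → suc k < M →
    diagSum (evenSum r) (suc k) + 2 * (is0 (π (suc k)) + is1 (σ (suc k))) ≤ 2 * suc (suc k)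
  evenRow-bound k k<M = begin
    F + T + 2 * (P + S)
      ≡⟨ solve 4 (λ f t p s → f :+ t :+ con 2 :* (p :+ s) :=
                              f :+ con 2 :* p :+ (t :+ con 2 :* s)) refl F T P S ⟩
    F + 2 * P + (T + 2 * S)
      ≤⟨ +-mono-≤ (foot-bound (suc k) k<M)
           (diagSum-≤ (λ y → evenSum r (suc y)) 2 (2 * S) k
             (λ y z e → r-even (suc y) z (subst (_< M) (cong suc (sym e)) k<M))
             (left-bound (suc k) k<M)) ⟩
    2 + suc k * 2
      ≡⟨ *-comm (suc (suc k)) 2 ⟩
    2 * suc (suc k) ∎
    where
    open ≤-Reasoning
    open +-*-Solver
    F = evenSum r 0 (suc k)
    T = diagSum (λ y → evenSum r (suc y)) k
    P = is0 (π (suc k))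
    S = is1 (σ (suc k))

  oddRow-bound : ∀ k → k < M → 2 * suc k ≤ diagSum (oddSum r) k
  oddRow-bound k k<M = ≤-trans (≤-reflexive (*-comm 2 (suc k)))
    (diagSum-≥ (oddSum r) 2 k λ y z e → r-odd y z (subst (_< M) (sym e) k<M))

  -- Comparing what row k emits with what row k + 1 absorbs and telescoping. The two sides without
  -- `rowWeight k` differ by twice the excess of the zeros of σ over those of π, which is the
  -- difference of heights.
  rowWeight-bound : ∀ k → k < M →
    rowWeight k + 2 * (zeros π (suc k) + ones σ (suc k)) ≤ 2 * suc k
  rowWeight-bound zero k<M
    -- The single even vertex of row 0 is a foot with an opening letter, so it absorbs nothing.
    rewrite σ-first | π-first
          | m+n≡0⇒m≡0 (r.a 0 0) (r-foot 0 k<M π-first) = ≤-refl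
  rowWeight-bound (suc k) k<M = +-cancelʳ-≤ (2 * suc k) _ _ (begin
    X′ + 2 * ((P + Z) + (S + N)) + 2 * suc k
      ≤⟨ +-monoʳ-≤ (X′ + 2 * ((P + Z) + (S + N)))
           (≤-trans (oddRow-bound k (<⇒≤ k<M)) (≤-reflexive (oddRow k))) ⟩
    X′ + 2 * ((P + Z) + (S + N)) + (X + Y)
      ≡⟨ solve 7 (λ x′ x y p z s n → x′ :+ con 2 :* ((p :+ z) :+ (s :+ n)) :+ (x :+ y) :=
                   (x′ :+ y :+ con 2 :* (p :+ s)) :+ (x :+ con 2 :* (z :+ n)))
                 refl X′ X Y P Z S N ⟩
    (X′ + Y + 2 * (P + S)) + (X + 2 * (Z + N))
      ≤⟨ +-mono-≤
           (≤-trans (≤-reflexive (cong (_+ 2 * (P + S)) (sym (evenRow k)))) (evenRow-bound k k<M))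
           (rowWeight-bound k (<⇒≤ k<M)) ⟩
    2 * suc (suc k) + 2 * suc k ∎)
    where
    open ≤-Reasoning
    open +-*-Solver
    X′ = rowWeight (suc k)
    X  = rowWeight k
    Y  = diagSum r.c k + diagSum r.u k
    P  = is0 (π (suc k))
    S  = is1 (σ (suc k))
    Z  = zeros π (suc k)
    N  = ones σ (suc k)

  -- Tight rows force r

  -- Equivalently, π has at least as many zeros as σ among the first m letters: the extreme case
  -- that `rowWeight-bound` allows.
  Tight : ℕ → Set
  Tight m = m ≤ zeros π m + ones σ m

  rowWeight-zero : ∀ k → k < M → Tight (suc k) → rowWeight k ≡ 0
  rowWeight-zero k k<M t = n≤0⇒n≡0 (+-cancelʳ-≤ (2 * suc k) _ _
    (≤-trans (+-monoʳ-≤ (rowWeight k) (*-monoʳ-≤ 2 t)) (rowWeight-bound k k<M)))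

  -- With no `r` left on the `a` and `d` edges of a tight row, an odd vertex must send both its
  -- units to the next row.
  odd-2≤ : ∀ y z → y + z < M → Tight (suc (y + z)) → 2 ≤ r.c y z + r.u y z
  odd-2≤ y z k<M t with rowWeight-zero (y + z) k<M t | r-odd y z k<M
  odd-2≤ zero    z k<M t | X≡0 | le
    rewrite diagSum-zero r.a z (m+n≡0⇒m≡0 _ X≡0) 0 z refl
          | +-identityʳ (r.u 0 z) = le
  odd-2≤ (suc y) z k<M t | X≡0 | le
    rewrite diagSum-zero r.a (suc y + z) (m+n≡0⇒m≡0 _ X≡0) (suc y) z refl
          | diagSum-zero r.d (y + z) (m+n≡0⇒n≡0 (diagSum r.a (suc y + z)) X≡0) y z refl
          | +-identityʳ (r.u (suc y) z) = le

  -- In a tight row the zero letter excludes the foot of the next row, and this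
  -- forces, from the bottom upwards, all edges of r to go up.
  strip-0 : ∀ y z → suc (y + z) < M → Tight (suc (y + z)) → π (suc (y + z)) ≡ 0F →
            r.c y z ≡ 0
  strip-0 zero    z lt t π0 =
    m+n≡0⇒m≡0 (r.c 0 z) (m+n≡0⇒n≡0 (r.a 0 (suc z)) (r-foot (suc z) lt π0))
  strip-0 (suc y) z lt t π0 = n≤0⇒n≡0 (+-cancelʳ-≤ 2 _ _ (begin
    r.c (suc y) z + 2
      ≤⟨ +-monoʳ-≤ _ (≤-trans (odd-2≤ y (suc z) (<⇒≤ lt′) t′)
           (≤-reflexive (cong (_+ r.u y (suc z))
             (strip-0 y (suc z) lt′ t′ (subst (λ k → π (suc k) ≡ 0F) (sym e) π0))))) ⟩
    r.c (suc y) z + r.u y (suc z)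
      ≤⟨ m≤m+n _ (r.a (suc y) (suc z) + r.d (suc y) z) ⟩
    r.c (suc y) z + r.u y (suc z) + (r.a (suc y) (suc z) + r.d (suc y) z)
      ≡⟨ solve 4 (λ c u a d → c :+ u :+ (a :+ d) := a :+ (u :+ (c :+ d))) refl
                 (r.c (suc y) z) (r.u y (suc z)) (r.a (suc y) (suc z)) (r.d (suc y) z) ⟩
    evenSum r (suc y) (suc z)
      ≤⟨ r-even (suc y) (suc z) (subst (_< M) (cong suc (sym e)) lt) ⟩
    2 ∎))
    where
    open ≤-Reasoning
    open +-*-Solver
    e : y + suc z ≡ suc (y + z)
    e = +-suc y z
    lt′ : suc (y + suc z) < M
    lt′ = subst (λ k → suc k < M) (sym e) lt
    t′ : Tight (suc (y + suc z))
    t′ = subst (λ k → Tight (suc k)) (sym e) t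

  -- Dually, the letter one excludes the left boundary vertex of the next row.
  strip-1 : ∀ y z → suc (y + z) < M → Tight (suc (y + z)) → σ (suc (y + z)) ≡ 1F →
            r.u y z ≡ 0
  strip-1 y zero    lt t σ1 rewrite +-identityʳ y =
    m+n≡0⇒m≡0 (r.u y 0) (m+n≡0⇒n≡0 (r.a (suc y) 0) (r-left (suc y) lt σ1))
  strip-1 y (suc z) lt t σ1 = n≤0⇒n≡0 (+-cancelʳ-≤ 2 _ _ (begin
    r.u y (suc z) + 2
      ≤⟨ +-monoʳ-≤ (r.u y (suc z)) (≤-trans (odd-2≤ (suc y) z (<⇒≤ lt′) t′)
           (≤-reflexive (trans (cong (r.c (suc y) z +_)
             (strip-1 (suc y) z lt′ t′ (subst (λ k → σ (suc k) ≡ 1F) e σ1))) (+-identityʳ _)))) ⟩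
    r.u y (suc z) + r.c (suc y) z
      ≤⟨ m≤m+n _ (r.a (suc y) (suc z) + r.d (suc y) z) ⟩
    r.u y (suc z) + r.c (suc y) z + (r.a (suc y) (suc z) + r.d (suc y) z)
      ≡⟨ solve 4 (λ c u a d → u :+ c :+ (a :+ d) := a :+ (u :+ (c :+ d))) refl
                 (r.c (suc y) z) (r.u y (suc z)) (r.a (suc y) (suc z)) (r.d (suc y) z) ⟩
    evenSum r (suc y) (suc z)
      ≤⟨ r-even (suc y) (suc z) lt ⟩
    2 ∎))
    where
    open ≤-Reasoning
    open +-*-Solver
    e : y + suc z ≡ suc (y + z)
    e = +-suc y z
    lt′ : suc (suc y + z) < M
    lt′ = subst (λ k → suc k < M) e lt
    t′ : Tight (suc (suc y + z))
    t′ = subst (λ k → Tight (suc k)) e t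

  -- Both units of `r` go up by `strip-0` and exhaust the total weight 2 of that edge.
  strip-0-b : ∀ y z → suc (y + z) < M → Tight (suc (y + z)) → π (suc (y + z)) ≡ 0F →
              b.u y z ≡ 0
  strip-0-b y z lt t π0 = n≤0⇒n≡0 (+-cancelˡ-≤ 2 _ _
    (≤-trans (+-monoˡ-≤ (b.u y z) 2≤u) (rb-u y z)))
    where
    2≤u : 2 ≤ r.u y z
    2≤u = subst (λ x → 2 ≤ x + r.u y z) (strip-0 y z lt t π0) (odd-2≤ y z (<⇒≤ lt) t)

  -- Both units of `r` go right by `strip-1`, and only an edge of the configuration can carry them.
  strip-1-g : ∀ y z → suc (y + z) < M → Tight (suc (y + z)) → σ (suc (y + z)) ≡ 1F →
              1 ≤ g.c y z
  strip-1-g y z lt t σ1 = *-cancelˡ-≤ 2 (≤-trans 2≤c (r-c y z))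
    where
    2≤c : 2 ≤ r.c y z
    2≤c = subst (2 ≤_) (+-identityʳ _)
            (subst (λ x → 2 ≤ r.c y z + x) (strip-1 y z lt t σ1) (odd-2≤ y z (<⇒≤ lt) t))

  -- The two persistent segments

  -- m is one more than the row number.
  Top Bottom : ℕ → ℕ → Set
  Top    m p = ∀ y z → suc (y + z) ≡ m → z < p → b.c y z ≡ 0 × b.u y z ≡ 0
  Bottom m q = ∀ y z → suc (y + z) ≡ m → y < q → 1 ≤ g.c y z × 1 ≤ g.u y z

  -- Induction on `z` from the left boundary. The `u` and `c` edges at `E y z` carry no `b` by
  -- hypothesis; the `d` edge carries none because its odd end is already filled through its own `a`
  -- edge. So the two units leaving `E y z` all take `a`. If the segment includes the foot, the
  -- hypothesis on π makes sure that no path ends there.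
  top-right : ∀ {m p} → m < M →
    (∀ y z → suc (y + z) ≡ m → z < p → b.u y z ≡ 0) →
    (∀ y z → y + suc z ≡ m → suc z < p → b.c y z ≡ 0) →
    (∀ z → z ≡ m → z < p → π z ≡ 0F) →
    ∀ y z → y + z ≡ m → z < p → 2 ≤ b.a y z
  top-right m<M hu hc hπ zero zero refl z<p
    = subst (2 ≤_) (+-identityʳ _) (b-even 0 0 m<M λ _ → hπ 0 refl z<p)
  top-right m<M hu hc hπ (suc y) zero refl z<p
    with le ← b-even (suc y) 0 m<M (λ ())
    rewrite hu y 0 refl z<p = subst (2 ≤_) (+-identityʳ _) le
  top-right {m} m<M hu hc hπ y (suc z) e z<p = subst (2 ≤_) eq le
    where
    e′ : suc y + z ≡ m
    e′ = trans (sym (+-suc y z)) e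
    d≡0 : b.d y z ≡ 0
    d≡0 = n≤0⇒n≡0 (+-cancelˡ-≤ 2 _ _ (begin
      2 + b.d y z
        ≤⟨ +-monoˡ-≤ _ (top-right m<M hu hc hπ (suc y) z e′ (<⇒≤ z<p)) ⟩
      b.a (suc y) z + b.d y z
        ≤⟨ +-monoʳ-≤ (b.a (suc y) z) (≤-trans (m≤n+m _ (b.u (suc y) z)) (m≤n+m _ (b.c (suc y) z))) ⟩
      oddSum b (suc y) z
        ≤⟨ b-odd (suc y) z (subst (_< M) (sym e′) m<M) ⟩
      2 ∎))
      where open ≤-Reasoning
    le : 2 ≤ evenSum b y (suc z)
    le = b-even y (suc z) (subst (_< M) (sym e) m<M) λ { refl → hπ (suc z) e z<p }
    u≡0 : prev (λ y′ → b.u y′ (suc z)) y ≡ 0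
    u≡0 = go y e where
      go : ∀ y → y + suc z ≡ m → prev (λ y′ → b.u y′ (suc z)) y ≡ 0
      go zero    _ = refl
      go (suc y) e = hu y (suc z) e z<p
    eq : evenSum b y (suc z) ≡ b.a y (suc z)
    eq = trans (cong (b.a y (suc z) +_) (cong₂ _+_ u≡0 (cong₂ _+_ (hc y z e z<p) d≡0)))
               (+-identityʳ _)

  top-next : ∀ {m p} → m < M → (∀ y z → y + z ≡ m → z < p → 2 ≤ b.a y z) → Top (suc m) p
  top-next m<M h y z e z<p = m+n≡0⇒m≡0 _ rest≡0 , m+n≡0⇒m≡0 _ (m+n≡0⇒n≡0 (b.c y z) rest≡0)
    where
    e′ = suc-injective e
    rest≡0 : b.c y z + (b.u y z + prev (λ y′ → b.d y′ z) y) ≡ 0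
    rest≡0 = n≤0⇒n≡0 (+-cancelˡ-≤ 2 _ _ (≤-trans (+-monoˡ-≤ _ (h y z e′ z<p))
                        (b-odd y z (subst (_< M) (sym e′) m<M))))

  top-keep : ∀ {m p} → m < M → p ≤ m → Top m p → Top (suc m) p
  top-keep m<M p≤m s = top-next m<M (top-right m<M
    (λ y z e z<p → proj₂ (s y z e z<p))
    (λ y z e z<p → proj₁ (s y z (trans (sym (+-suc y z)) e) (<⇒≤ z<p)))
    -- As `p ≤ m`, the segment stops short of the foot, so the letter of π is free.
    (λ { z refl z<p → contradiction (≤-trans z<p p≤m) (<-irrefl refl) }))

  -- `top-right` wants `u` one column further than `c`. In the new column p, `strip-0-b` supplies
  -- `u`, while the `c` edges still come from the old segment.
  top-0 : ∀ {m p} → m < M → p ≤ m → Tight m → π m ≡ 0F → Top m p → Top (suc m) (suc p)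
  top-0 m<M p≤m t π0 s = top-next m<M (top-right m<M
    (λ { y z refl z<p → strip-0-b y z m<M t π0 })
    (λ { y z e (s≤s z<p) → proj₁ (s y z (trans (sym (+-suc y z)) e) z<p) })
    (λ { z refl z<p → π0 }))

  -- An even vertex with both its `u` and `c` edges, or a foot with its external edge and `c`, has
  -- no room for `a` and `d`. The odd vertices of the segment thus get nothing from their own row,
  -- and their two edges must be `c` and `u`. The last hypothesis keeps out the left boundary
  -- vertex, whose `a` edge is always present.
  bottom-next : ∀ {m q} → m < M →
    (∀ y z → suc (y + z) ≡ m → suc y < q → 1 ≤ g.u y z) →
    (∀ y z → y + suc z ≡ m → y < q → 1 ≤ g.c y z) →
    (m < q → ⊥) →
    Bottom (suc m) q
  bottom-next {m} {q} m<M hu hc hl = λ y z e y<q → next y z (suc-injective e) y<q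
    where
    open ≤-Reasoning
    right-down : ∀ y z → y + suc z ≡ m → y < q → g.a y (suc z) + g.d y z ≡ 0
    right-down zero z e y<q = n≤0⇒n≡0 (+-cancelˡ-≤ 1 _ _ (begin
      1 + (g.a 0 (suc z) + g.d 0 z)
        ≤⟨ +-monoˡ-≤ _ (hc 0 z e y<q) ⟩
      g.c 0 z + (g.a 0 (suc z) + g.d 0 z)
        ≡⟨ solve 3 (λ a c d → c :+ (a :+ d) := a :+ (c :+ d)) refl
                   (g.a 0 (suc z)) (g.c 0 z) (g.d 0 z) ⟩
      evenSum g 0 (suc z)
        ≤⟨ g-foot (suc z) (subst (_< M) (sym e) m<M) ⟩
      1 ∎))
      where open +-*-Solver
    right-down (suc y) z e y<q = n≤0⇒n≡0 (+-cancelˡ-≤ 2 _ _ (begin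
      2 + (g.a (suc y) (suc z) + g.d (suc y) z)
        ≤⟨ +-monoˡ-≤ _ (+-mono-≤ (hu y (suc z) e y<q) (hc (suc y) z e y<q)) ⟩
      g.u y (suc z) + g.c (suc y) z + (g.a (suc y) (suc z) + g.d (suc y) z)
        ≡⟨ solve 4 (λ a c d u → u :+ c :+ (a :+ d) := a :+ (u :+ (c :+ d))) refl
                   (g.a (suc y) (suc z)) (g.c (suc y) z) (g.d (suc y) z) (g.u y (suc z)) ⟩
      evenSum g (suc y) (suc z)
        ≤⟨ g-even (suc y) (suc z) (subst (_< M) (sym e) m<M) ⟩
      2 ∎))
      where open +-*-Solver
    a≡0 : ∀ y z → y + z ≡ m → y < q → g.a y z ≡ 0
    a≡0 y zero    e y<q = contradiction (subst (_< q) (trans (sym (+-identityʳ y)) e) y<q) hl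
    a≡0 y (suc z) e y<q = m+n≡0⇒m≡0 _ (right-down y z e y<q)
    d≡0 : ∀ y z → y + z ≡ m → y < q → prev (λ y′ → g.d y′ z) y ≡ 0
    d≡0 zero    z e y<q = refl
    d≡0 (suc y) z e y<q = m+n≡0⇒n≡0 (g.a y (suc z)) (right-down y z (trans (+-suc y z) e) (<⇒≤ y<q))
    next : ∀ y z → y + z ≡ m → y < q → 1 ≤ g.c y z × 1 ≤ g.u y z
    next y z e y<q = big₁ (g-u≤1 y z) c+u , big₂ (g-c≤1 y z) c+u
      where
      c+u : g.c y z + g.u y z ≡ 2
      c+u = trans (cong₂ (λ x w → x + (g.c y z + w)) (sym (a≡0 y z e y<q))
                     (trans (sym (+-identityʳ _)) (cong (g.u y z +_) (sym (d≡0 y z e y<q)))))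
                  (g-odd y z (subst (_< M) (sym e) m<M))
      big₁ : ∀ {x w} → w ≤ 1 → x + w ≡ 2 → 1 ≤ x
      big₁ {zero} (s≤s ()) refl
      big₁ {suc x} _ _ = s≤s z≤n
      big₂ : ∀ {x w} → x ≤ 1 → x + w ≡ 2 → 1 ≤ w
      big₂ {x} {w} p q = big₁ p (trans (+-comm w x) q)

  bottom-keep : ∀ {m q} → m < M → q ≤ m → Bottom m q → Bottom (suc m) q
  bottom-keep m<M q≤m s = bottom-next m<M
    (λ y z e y<q → proj₂ (s y z e (<⇒≤ y<q)))
    (λ y z e y<q → proj₁ (s y z (trans (sym (+-suc y z)) e) y<q))
    (λ m<q → contradiction (≤-trans m<q q≤m) (<-irrefl refl))

  -- Here `c` is wanted one step further than `u`, and `strip-1-g` supplies it in the whole row.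
  bottom-1 : ∀ {m q} → m < M → q ≤ m → Tight m → σ m ≡ 1F → Bottom m q → Bottom (suc m) (suc q)
  bottom-1 {m} {q} m<M q≤m t σ1 s = bottom-next m<M
    (λ { y z e (s≤s y<q) → proj₂ (s y z e y<q) })
    (λ y z e y<q → let e′ = trans (sym (+-suc y z)) e in
       strip-1-g y z (subst (_< M) (sym e′) m<M) (subst Tight (sym e′) t)
                 (subst (λ k → σ k ≡ 1F) (sym e′) σ1))
    (notLeft m<M σ1 s)
    where
    -- The longer segment could reach the left boundary only if the old one filled its whole row;
    -- then `O k 0` would have the three edges `a`, `c` and `u`.
    notLeft : ∀ {m} → m < M → σ m ≡ 1F → Bottom m q → m < suc q → ⊥
    notLeft {zero}  _   σ1 _ _         with () ← trans (sym σ1) σ-first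
    notLeft {suc k} m<M σ1 s (s≤s k<q) with s k 0 (cong suc (+-identityʳ k)) k<q
    ... | 1≤c , 1≤u = <-irrefl refl (begin-strict
      2 <⟨ +-mono-≤ (g-left k (<⇒≤ m<M)) (+-mono-≤ 1≤c 1≤u) ⟩
      g.a k 0 + (g.c k 0 + g.u k 0)
        ≤⟨ +-monoʳ-≤ (g.a k 0) (+-monoʳ-≤ (g.c k 0) (m≤m+n _ _)) ⟩
      oddSum g k 0 ≡⟨ g-odd k 0 (subst (_< M) (sym (+-identityʳ k)) (<⇒≤ m<M)) ⟩
      2 ∎)
      where open ≤-Reasoning

  -- Reading the letters one by one

  State : ℕ → ℕ → ℕ → Set
  State m p q = p ≤ m × q ≤ m × Top m p × Bottom m q

  Final : ℕ → ℕ → Set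
  Final p q = (∀ z → z < p → τ z ≡ 0F) × (∀ y z → y + z ≡ M → y < q → τ z ≡ 1F)

  -- A letter 1 of τ brings two units of `b` onto the `u` and `c` edges of its vertex, where `Top`
  -- allows none; and the `u` edges granted by `Bottom` are the vertical edges that make a letter of
  -- τ equal to 1. The additional unit is the last letter of τ, which is always 1.
  final : ∀ {p q} → State M p q → Final p (suc q)
  final {p} {q} (p≤M , q≤M , top , bottom) = front , back
    where
    front : ∀ z → z < p → τ z ≡ 0F
    front zero    z<p = τ-first
    front (suc z) z<p with τ (suc z) in eq
    ... | 0F = refl
    ... | 1F = contradiction
      (subst₂ (λ x w → 2 ≤ x + w)
        (proj₂ (top y (suc z) (trans (cong suc (+-suc y z)) e) z<p))
        (proj₁ (top (suc y) z e (<⇒≤ z<p)))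
        (b-right y z e eq)) λ ()
      where
      y = M ∸ suc (suc z)
      e : suc (suc (y + z)) ≡ M
      e = trans (trans (cong suc (sym (+-suc y z))) (sym (+-suc y (suc z)))) (m∸n+n≡m (≤-trans z<p p≤M))
    back : ∀ y z → y + z ≡ M → y < suc q → τ z ≡ 1F
    back zero    z refl y<q       = τ-last
    back (suc y) z e    (s≤s y<q) = g-right y z e (proj₂ (bottom y z e y<q))

  -- Row M has no odd vertices, so reading the letter of index M turns a `State` into a `Final`.
  -- This letter is 1 in π, hence never a common 0; a common 1 is counted by the additional unit in
  -- `final`.
  Reached : ℕ → ℕ → ℕ → Set
  Reached m p q = (m ≤ M → State m p q) × (m ≡ suc M → Final p q)

  start : Reached 0 0 0
  start = (λ _ → z≤n , z≤n , (λ _ _ ()) , (λ _ _ ())) , λ ()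

  step-keep : ∀ {m p q} → m ≤ M → Reached m p q → Reached (suc m) p q
  step-keep m≤M (s , _) =
    (λ m<M → let (p≤m , q≤m , top , bottom) = s m≤M in
       m≤n⇒m≤1+n p≤m , m≤n⇒m≤1+n q≤m , top-keep m<M p≤m top , bottom-keep m<M q≤m bottom) ,
    -- The additional unit of `final` is given away, since this letter does not count.
    (λ { refl → let (f , l) = final (s m≤M) in f , λ y z e y<q → l y z e (m≤n⇒m≤1+n y<q) })

  step-0 : ∀ {m p q} → m ≤ M → Tight m → π m ≡ 0F → Reached m p q → Reached (suc m) (suc p) q
  step-0 m≤M t π0 (s , _) =
    (λ m<M → let (p≤m , q≤m , top , bottom) = s m≤M in
       s≤s p≤m , m≤n⇒m≤1+n q≤m , top-0 m<M p≤m t π0 top , bottom-keep m<M q≤m bottom) ,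
    (λ { refl → contradiction (trans (sym π0) π-last) λ () })

  step-1 : ∀ {m p q} → m ≤ M → Tight m → σ m ≡ 1F → Reached m p q → Reached (suc m) p (suc q)
  step-1 m≤M t σ1 (s , _) =
    (λ m<M → let (p≤m , q≤m , top , bottom) = s m≤M in
       m≤n⇒m≤1+n p≤m , s≤s q≤m , top-keep m<M p≤m top , bottom-1 m<M q≤m t σ1 bottom) ,
    (λ { refl → final (s m≤M) })

-- Words as functions of the position

-- The value beyond the end of the word is irrelevant.
nth : Word → ℕ → Fin 2
nth []      _       = 1F
nth (x ∷ w) zero    = x
nth (x ∷ w) (suc m) = nth w m

nth-toList : ∀ {k} (xs : Vec (Fin 2) k) i → nth (toList xs) (toℕ i) ≡ lookup xs i
nth-toList (x ∷ xs) Fin.zero    = refl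
nth-toList (x ∷ xs) (Fin.suc i) = nth-toList xs i

Reads : (ℕ → Fin 2) → ℕ → Word → Set
Reads f m []      = ⊤
Reads f m (x ∷ w) = f m ≡ x × Reads f (suc m) w

reads-∷ : ∀ x w m v → Reads (nth w) m v → Reads (nth (x ∷ w)) (suc m) v
reads-∷ x w m []      _       = tt
reads-∷ x w m (y ∷ v) (e , h) = e , reads-∷ x w (suc m) v h

reads-prefix : ∀ u w → Reads (nth (u ++ w)) 0 u
reads-prefix []      w = tt
reads-prefix (x ∷ u) w = refl , reads-∷ x (u ++ w) 0 u (reads-prefix u w)

reads-suffix : ∀ u v → Reads (nth (u ++ v)) (length u) v
reads-suffix []      v = subst (λ w → Reads (nth w) 0 v) (List.++-identityʳ v) (reads-prefix v [])
reads-suffix (x ∷ u) v = reads-∷ x (u ++ v) (length u) v (reads-suffix u v)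

zeros-∷ : ∀ x w m → zeros (nth (x ∷ w)) (suc m) ≡ is0 x + zeros (nth w) m
zeros-∷ x w zero    = refl
zeros-∷ x w (suc m) = trans (cong (is0 (nth w m) +_) (zeros-∷ x w m))
  (trans (sym (+-assoc (is0 (nth w m)) (is0 x) _))
  (trans (cong (_+ zeros (nth w) m) (+-comm (is0 (nth w m)) (is0 x))) (+-assoc (is0 x) _ _)))

ones-∷ : ∀ x w m → ones (nth (x ∷ w)) (suc m) ≡ is1 x + ones (nth w) m
ones-∷ x w zero    = refl
ones-∷ x w (suc m) = trans (cong (is1 (nth w m) +_) (ones-∷ x w m))
  (trans (sym (+-assoc (is1 (nth w m)) (is1 x) _))
  (trans (cong (_+ ones (nth w) m) (+-comm (is1 (nth w m)) (is1 x))) (+-assoc (is1 x) _ _)))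

∣∷∣₀ : ∀ x w → ∣ x ∷ w ∣₀ ≡ is0 x + ∣ w ∣₀
∣∷∣₀ 0F w = refl
∣∷∣₀ 1F w = refl

∣∷∣₁ : ∀ x w → ∣ x ∷ w ∣₁ ≡ is1 x + ∣ w ∣₁
∣∷∣₁ 0F w = refl
∣∷∣₁ 1F w = refl

zeros-length : ∀ w → zeros (nth w) (length w) ≡ ∣ w ∣₀
zeros-length []      = refl
zeros-length (x ∷ w) =
  trans (zeros-∷ x w (length w)) (trans (cong (is0 x +_) (zeros-length w)) (sym (∣∷∣₀ x w)))

ones-length : ∀ w → ones (nth w) (length w) ≡ ∣ w ∣₁
ones-length []      = refl
ones-length (x ∷ w) =
  trans (ones-∷ x w (length w)) (trans (cong (is1 x +_) (ones-length w)) (sym (∣∷∣₁ x w)))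

replicate-prefix : ∀ c w p → p ≤ length w → (∀ z → z < p → nth w z ≡ c) →
                   take p w ≡ replicate p c
replicate-prefix c w       zero    _       h = refl
replicate-prefix c (x ∷ w) (suc p) (s≤s l) h =
  cong₂ _∷_ (h 0 (s≤s z≤n)) (replicate-prefix c w p l λ z l → h (suc z) (s≤s l))

nth-drop : ∀ w k i → nth (drop k w) i ≡ nth w (k + i)
nth-drop w       zero    i = refl
nth-drop []      (suc k) i = refl
nth-drop (x ∷ w) (suc k) i = nth-drop w k i

split-word : ∀ w p q → p + q ≤ length w →
  (∀ z → z < p → nth w z ≡ 0F) →
  (∀ y z → suc (y + z) ≡ length w → y < q → nth w z ≡ 1F) →
  ∃[ w′ ] w ≡ replicate p 0F ++ w′ ++ replicate q 1F
split-word w p q l h0 h1 = take k w₁ , (begin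
  w                                        ≡⟨ List.take++drop≡id p w ⟨
  take p w ++ w₁                           ≡⟨ cong₂ _++_ (replicate-prefix 0F w p p≤ h0)
                                                  (sym (List.take++drop≡id k w₁)) ⟩
  replicate p 0F ++ take k w₁ ++ drop k w₁ ≡⟨ cong (λ s → replicate p 0F ++ take k w₁ ++ s) suffix ⟩
  replicate p 0F ++ take k w₁ ++ replicate q 1F ∎)
  where
  open ≡-Reasoning
  w₁ = drop p w
  k  = length w₁ ∸ q
  p≤ : p ≤ length w
  p≤ = ≤-trans (m≤m+n p q) l
  len₁ : p + length w₁ ≡ length w
  len₁ = trans (cong (p +_) (List.length-drop p w)) (m+[n∸m]≡n p≤)
  q≤ : q ≤ length w₁
  q≤ = +-cancelˡ-≤ p _ _ (≤-trans l (≤-reflexive (sym len₁)))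
  k+q : k + q ≡ length w₁
  k+q = m∸n+n≡m q≤
  len₂ : length (drop k w₁) ≡ q
  len₂ = trans (List.length-drop k w₁) (m∸[m∸n]≡n q≤)
  take-all : ∀ (v : Word) n → length v ≡ n → take n v ≡ v
  take-all []      .0 refl = refl
  take-all (x ∷ v) _  refl = cong (x ∷_) (take-all v _ refl)
  suffix : drop k w₁ ≡ replicate q 1F
  suffix = trans (sym (take-all (drop k w₁) q len₂))
    (replicate-prefix 1F (drop k w₁) q (≤-reflexive (sym len₂)) λ z z<q →
      trans (nth-drop w₁ k z) (trans (nth-drop w p (k + z))
        -- The letter at position z of the suffix has `q ∸ suc z` letters behind it.
        (h1 (q ∸ suc z) (p + (k + z)) (index z z<q) (before z z<q))))
    where
    before : ∀ z → z < q → q ∸ suc z < q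
    before z (s≤s {n = n} _) = s≤s (m∸n≤m n z)
    index : ∀ z → z < q → suc (q ∸ suc z + (p + (k + z))) ≡ length w
    index z z<q = trans (cong suc (trans (+-comm (q ∸ suc z) _) 
                   (trans (+-assoc p (k + z) _) (cong (p +_) (+-assoc k z _)))))
      (trans (sym (+-suc p _)) (trans (cong (p +_)
        (trans (sym (+-suc k _)) (trans (cong (k +_) (m+[n∸m]≡n z<q)) k+q))) len₁))

-- Running through prefix, middle and suffix

module _ {M σ τ π} (I : Ice M σ τ π) where

  run-keep : ∀ {p q} l m → m + l ≤ suc M → Reached I m p q → Reached I (m + l) p q
  run-keep zero    m le s rewrite +-identityʳ m = s
  run-keep (suc l) m le s rewrite +-suc m l =
    run-keep l (suc m) le (step-keep I (≤-trans (m≤m+n m l) (≤-pred le)) s)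

  tight-suc : ∀ m x → π m ≡ x → σ m ≡ x → Tight I m → Tight I (suc m)
  tight-suc m 0F e e′ t rewrite e | e′ = s≤s t
  tight-suc m 1F e e′ t rewrite e | e′ = ≤-trans (s≤s t) (≤-reflexive (sym (+-suc (zeros π m) _)))

  tight-pred : ∀ m x → π m ≡ x → σ m ≡ x → Tight I (suc m) → Tight I m
  tight-pred m 0F e e′ t rewrite e | e′ = ≤-pred t
  tight-pred m 1F e e′ t rewrite e | e′ = ≤-pred (≤-trans t (≤-reflexive (+-suc (zeros π m) _)))

  -- A common letter raises both sides of the inequality by one, so tightness also travels
  -- backwards. Before the suffix it is obtained in this way from the end of the words.
  tight-back : ∀ w m → Reads π m w → Reads σ m w → Tight I (m + length w) → Tight I m
  tight-back []      m _       _         t rewrite +-identityʳ m = t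
  tight-back (x ∷ w) m (e , h) (e′ , h′) t rewrite +-suc m (length w) =
    tight-pred m x e e′ (tight-back w (suc m) h h′ t)

  run-common : ∀ w m {p q} → Reads π m w → Reads σ m w → m + length w ≤ suc M → Tight I m →
    Reached I m p q → Reached I (m + length w) (∣ w ∣₀ + p) (∣ w ∣₁ + q)
  run-common []       m _       _         le t s rewrite +-identityʳ m = s
  run-common (0F ∷ w) m {p} {q} (e , h) (e′ , h′) le t s
    rewrite +-suc m (length w) | sym (+-suc ∣ w ∣₀ p) =
    run-common w (suc m) h h′ le (tight-suc m 0F e e′ t)
      (step-0 I (≤-trans (m≤m+n m _) (≤-pred le)) t e s)
  run-common (1F ∷ w) m {p} {q} (e , h) (e′ , h′) le t s
    rewrite +-suc m (length w) | sym (+-suc ∣ w ∣₁ q) =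
    run-common w (suc m) h h′ le (tight-suc m 1F e e′ t)
      (step-1 I (≤-trans (m≤m+n m _) (≤-pred le)) t e′ s)

common-parts : ∀ {M} (s t p : Word) → Ice M (nth s) (nth t) (nth p) →
  length s ≡ suc M → length t ≡ suc M → length p ≡ suc M → ∣ p ∣₀ + ∣ s ∣₁ ≡ suc M →
  (u s′ p′ v : Word) → s ≡ u ++ s′ ++ v → p ≡ u ++ p′ ++ v →
  (P Q : ℕ) → P ≡ ∣ u ∣₀ + ∣ v ∣₀ → Q ≡ ∣ u ∣₁ + ∣ v ∣₁ → P + Q ≤ suc M →
  ∃[ t′ ] t ≡ replicate P 0F ++ t′ ++ replicate Q 1F
common-parts {M} s t p I ls lt lp balance u s′ p′ v refl refl P Q refl refl PQ =
  split-word t P Q (subst (P + Q ≤_) (sym lt) PQ) (proj₁ fin)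
    λ y z e → proj₂ fin y z (suc-injective (trans e lt))
  where
  m : ℕ
  m = length u + length s′
  total : m + length v ≡ suc M
  total = trans (+-assoc (length u) _ _)
    (trans (sym (trans (List.length-++ u) (cong (length u +_) (List.length-++ s′)))) ls)
  same : length s′ ≡ length p′
  same = +-cancelʳ-≡ (length v) _ _ (+-cancelˡ-≡ (length u) _ _
    (trans (sym (trans (List.length-++ u) (cong (length u +_) (List.length-++ s′))))
    (trans (trans ls (sym lp)) (trans (List.length-++ u) (cong (length u +_) (List.length-++ p′))))))
  suffix : ∀ w′ → length s′ ≡ length w′ → Reads (nth (u ++ w′ ++ v)) m v
  suffix w′ e = subst₂ (λ x k → Reads (nth x) k v) (List.++-assoc u w′ v)
    (trans (List.length-++ u) (cong (length u +_) (sym e))) (reads-suffix (u ++ w′) v)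
  endTight : Tight I (m + length v)
  endTight = ≤-reflexive (trans total (trans (sym balance) (cong₂ _+_
    (trans (sym (zeros-length p)) (cong (zeros (nth p)) (trans lp (sym total))))
    (trans (sym (ones-length s)) (cong (ones (nth s)) (trans ls (sym total)))))))
  m≤ : m ≤ suc M
  m≤ = ≤-trans (m≤m+n m _) (≤-reflexive total)
  reached : Reached I (m + length v) (∣ v ∣₀ + (∣ u ∣₀ + 0)) (∣ v ∣₁ + (∣ u ∣₁ + 0))
  reached = run-common I v m (suffix p′ same) (suffix s′ refl) (≤-reflexive total)
    (tight-back I v m (suffix p′ same) (suffix s′ refl) endTight)
    (run-keep I (length s′) (length u) m≤
      (run-common I u 0 (reads-prefix u _) (reads-prefix u _) (≤-trans (m≤m+n _ _) m≤) z≤n (start I)))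
  reorder : ∀ x y → x + (y + 0) ≡ y + x
  reorder x y = trans (cong (x +_) (+-identityʳ y)) (+-comm x y)
  fin : Final I P Q
  fin = subst₂ (Final I) (reorder ∣ v ∣₀ ∣ u ∣₀) (reorder ∣ v ∣₁ ∣ u ∣₁) (proj₂ reached total)

-- Indicators and finite sums

𝟙 : ∀ {P : Set} → Dec P → ℕ
𝟙 (yes _) = 1
𝟙 (no _)  = 0

𝟙-yes : ∀ {P : Set} (d : Dec P) → P → 𝟙 d ≡ 1
𝟙-yes (yes _) p = refl
𝟙-yes (no ¬p) p = contradiction p ¬p

𝟙-no : ∀ {P : Set} (d : Dec P) → ¬ P → 𝟙 d ≡ 0
𝟙-no (yes p) ¬p = contradiction p ¬p
𝟙-no (no _)  ¬p = refl

𝟙-cong : ∀ {P Q : Set} (d : Dec P) (e : Dec Q) → (P → Q) → (Q → P) → 𝟙 d ≡ 𝟙 e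
𝟙-cong (yes p) e to from = sym (𝟙-yes e (to p))
𝟙-cong (no ¬p) e to from = sym (𝟙-no e (¬p ∘ from))

module _ {A : Set} where

  ∑ : List A → (A → ℕ) → ℕ
  ∑ xs f = sum (map f xs)

  ∑-cong : ∀ {f g : A → ℕ} xs → (∀ x → f x ≡ g x) → ∑ xs f ≡ ∑ xs g
  ∑-cong []       h = refl
  ∑-cong (x ∷ xs) h = cong₂ _+_ (h x) (∑-cong xs h)

  ∑-+ : ∀ (f g : A → ℕ) xs → ∑ xs (λ x → f x + g x) ≡ ∑ xs f + ∑ xs g
  ∑-+ f g []       = refl
  ∑-+ f g (x ∷ xs) = trans (cong (f x + g x +_) (∑-+ f g xs)) (swap-middle (f x) _ _ _)

  ∑-zero : ∀ (f : A → ℕ) xs → (∀ x → x ∈ xs → f x ≡ 0) → ∑ xs f ≡ 0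
  ∑-zero f []       h = refl
  ∑-zero f (x ∷ xs) h = cong₂ _+_ (h x (here refl)) (∑-zero f xs λ y → h y ∘ there)

  ∑-member : ∀ (f : A → ℕ) {x} xs → x ∈ xs → f x ≤ ∑ xs f
  ∑-member f (x ∷ xs) (here refl) = m≤m+n _ _
  ∑-member f (x ∷ xs) (there p)   = ≤-trans (∑-member f xs p) (m≤n+m _ (f x))

  ∑-𝟙 : ∀ {P : A → Set} (P? : ∀ x → Dec (P x)) {x₀} xs → Unique xs → x₀ ∈ xs →
        P x₀ → (∀ x → P x → x ≡ x₀) → ∑ xs (λ x → 𝟙 (P? x)) ≡ 1
  ∑-𝟙 P? (x ∷ xs) (x∉ ∷ u) (here refl) p h = cong₂ _+_ (𝟙-yes (P? x) p)
    (∑-zero _ xs λ y y∈ → 𝟙-no (P? y) λ q → All.lookup x∉ y∈ (sym (h y q)))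
  ∑-𝟙 P? (x ∷ xs) (x∉ ∷ u) (there x₀∈) p h = cong₂ _+_
    (𝟙-no (P? x) λ q → All.lookup x∉ x₀∈ (h x q)) (∑-𝟙 P? xs u x₀∈ p h)

∑-swap : ∀ {A B : Set} (f : A → B → ℕ) xs ys →
         ∑ xs (λ x → ∑ ys (f x)) ≡ ∑ ys (λ y → ∑ xs (λ x → f x y))
∑-swap f []       ys = sym (∑-zero _ ys λ _ _ → refl)
∑-swap f (x ∷ xs) ys = trans (cong (∑ ys (f x) +_) (∑-swap f xs ys))
                             (sym (∑-+ (f x) (λ y → ∑ xs (λ x′ → f x′ y)) ys))

-- Paths from sources to sinks are disjoint

endOf : ∀ {A : Set} → A → List A → A
endOf a []       = a
endOf a (b ∷ bs) = endOf b bs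

endOf-∈ : ∀ {A : Set} (a : A) bs → endOf a bs ∈ a ∷ bs
endOf-∈ a []       = here refl
endOf-∈ a (b ∷ bs) = there (endOf-∈ b bs)

module PathFlow {V : Set} (_≟_ : DecidableEquality V)
  (G : V → V → ℕ) (G-sym : ∀ v w → G v w ≡ G w v)
  (Source Sink : V → Set) (source∩sink : ∀ {v} → Source v → ¬ Sink v)
  (degree≤2 : ∀ {v u w z} → 1 ≤ G v u → 1 ≤ G v w → u ≢ w → 1 ≤ G v z → z ≡ u ⊎ z ≡ w)
  (degree≤1 : ∀ {v u w} → Source v ⊎ Sink v → 1 ≤ G v u → 1 ≤ G v w → u ≡ w) where

  open DecMembership _≟_ using (_∈?_)

  Adj : V → V → Set
  Adj v w = 1 ≤ G v w

  Adj-sym : ∀ {v w} → Adj v w → Adj w v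
  Adj-sym {v} {w} = subst (1 ≤_) (G-sym v w)

  record Path : Set where
    field
      first  : V
      rest   : List V
      source : Source first
      sink   : Sink (endOf first rest)
      linked : Linked Adj (first ∷ rest)
      simple : Unique (first ∷ rest)

    target : V
    target = endOf first rest

    visited : List V
    visited = first ∷ rest

  open Path

  -- Predecessor and successor, distinct on a simple path, are all the neighbours of an interior
  -- vertex; the last vertex is a sink, so its predecessor is its only neighbour.
  tail-closed : ∀ {u v vs x w} → Adj u v → Linked Adj (v ∷ vs) → Unique (u ∷ v ∷ vs) →
                Sink (endOf v vs) → x ∈ v ∷ vs → Adj x w → w ∈ u ∷ v ∷ vs
  tail-closed {vs = []} a l s k (here refl) b = here (degree≤1 (inj₂ k) b (Adj-sym a))
  tail-closed {vs = z ∷ vs} a (c ∷ l) ((_ ∷ u≢z ∷ _) ∷ s) k (here refl) b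
    with degree≤2 (Adj-sym a) c u≢z b
  ... | inj₁ w≡u = here w≡u
  ... | inj₂ w≡z = there (there (here w≡z))
  tail-closed {vs = z ∷ vs} a (c ∷ l) (_ ∷ s) k (there x∈) b = there (tail-closed c l s k x∈ b)

  -- Since all degrees are at most two, and at most one at the ends of a path, a
  -- path is a connected component; hence paths with different starts are disjoint.
  closed : ∀ p {x w} → x ∈ visited p → Adj x w → w ∈ visited p
  closed record { rest = [] ; source = s ; sink = k } _ _ = contradiction k (source∩sink s)
  closed record { rest = v ∷ vs ; source = s ; linked = a ∷ _ } (here refl) b =
    there (here (degree≤1 (inj₁ s) b a))
  closed record { rest = v ∷ vs ; sink = k ; linked = a ∷ l ; simple = u } (there x∈) b =
    tail-closed a l u k x∈ b

  tail-sourceless : ∀ {u v vs x} → Adj u v → Linked Adj (v ∷ vs) → Unique (u ∷ v ∷ vs) →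
                    Sink (endOf v vs) → x ∈ v ∷ vs → ¬ Source x
  tail-sourceless {vs = []} a l s k (here refl) x-source = source∩sink x-source k
  tail-sourceless {vs = z ∷ vs} a (c ∷ l) ((_ ∷ u≢z ∷ _) ∷ s) k (here refl) x-source =
    u≢z (degree≤1 (inj₁ x-source) (Adj-sym a) c)
  tail-sourceless {vs = z ∷ vs} a (c ∷ l) (_ ∷ s) k (there x∈) x-source =
    tail-sourceless c l s k x∈ x-source

  source-first : ∀ p {x} → x ∈ visited p → Source x → x ≡ first p
  source-first p (here x≡) s = x≡
  source-first record { rest = v ∷ vs ; sink = k ; linked = a ∷ l ; simple = u } (there x∈) s =
    contradiction s (tail-sourceless a l u k x∈)

  reach-first : ∀ p {v vs x} → Linked Adj (v ∷ vs) → x ∈ v ∷ vs → x ∈ visited p → v ∈ visited p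
  reach-first p l       (here refl) y = y
  reach-first p (a ∷ l) (there x∈)  y = closed p (reach-first p l x∈ y) (Adj-sym a)

  Apart : Path → Path → Set
  Apart p q = ∀ {x} → x ∈ visited p → x ∉ visited q

  -- From a common vertex, following q backwards never leaves p, as p is closed. So the start of q
  -- lies on p, whose only source is its own start.
  apart : ∀ {p q} → first p ≢ first q → Apart p q
  apart {p} {q} p≢q x∈p x∈q =
    p≢q (sym (source-first p (reach-first p (linked q) x∈q x∈p) (source q)))

  -- The flow along the paths

  steps : V → V → V → List V → ℕ
  steps v w a []       = 0
  steps v w a (b ∷ bs) = 𝟙 (a ≟ v ×-dec b ≟ w) + steps v w b bs

  steps-absentˡ : ∀ v w a bs → v ∉ a ∷ bs → steps v w a bs ≡ 0
  steps-absentˡ v w a []       v∉ = refl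
  steps-absentˡ v w a (b ∷ bs) v∉ = cong₂ _+_
    (𝟙-no (a ≟ v ×-dec b ≟ w) λ { (refl , _) → v∉ (here refl) })
    (steps-absentˡ v w b bs (v∉ ∘ there))

  steps-absentʳ : ∀ v w a bs → w ∉ a ∷ bs → steps v w a bs ≡ 0
  steps-absentʳ v w a []       w∉ = refl
  steps-absentʳ v w a (b ∷ bs) w∉ = cong₂ _+_
    (𝟙-no (a ≟ v ×-dec b ≟ w) λ { (_ , refl) → w∉ (there (here refl)) })
    (steps-absentʳ v w b bs (w∉ ∘ there))

  -- A simple path never returns to `a`, so it uses an edge at most once and in one direction only.
  steps-bound : ∀ v w a bs → Linked Adj (a ∷ bs) → Unique (a ∷ bs) →
                steps v w a bs + steps w v a bs ≤ G v w
  steps-bound v w a []       l       u = z≤n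
  steps-bound v w a (b ∷ bs) (c ∷ l) (a∉ ∷ u) with a ≟ v ×-dec b ≟ w | a ≟ w ×-dec b ≟ v
  ... | no _            | no _            = steps-bound v w b bs l u
  ... | yes (refl , refl) | yes (refl , _)  = contradiction refl (All.lookup a∉ (here refl))
  ... | yes (refl , refl) | no _ = ≤-trans (≤-reflexive (cong suc
    (cong₂ _+_ (steps-absentˡ a b b bs (All.All¬⇒¬Any a∉)) (steps-absentʳ b a b bs (All.All¬⇒¬Any a∉))))) c
  ... | no _ | yes (refl , refl) = ≤-trans (≤-reflexive
    (cong₂ (λ x y → x + suc y) (steps-absentʳ b a b bs (All.All¬⇒¬Any a∉))
                               (steps-absentˡ a b b bs (All.All¬⇒¬Any a∉)))) (Adj-sym c)

  -- Every passage through `v` is one arrival and one departure; the two indicators correct for the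
  -- ends of the walk.
  steps-balance : ∀ v a bs N → Unique N → (∀ w → Adj v w → w ∈ N) → Linked Adj (a ∷ bs) →
    ∑ N (λ w → steps v w a bs) + 𝟙 (endOf a bs ≟ v) ≡ ∑ N (λ w → steps w v a bs) + 𝟙 (a ≟ v)
  steps-balance v a []       N uN cover l = refl
  steps-balance v a (b ∷ bs) N uN cover (c ∷ l) = begin
    ∑ N (λ w → 𝟙 (a ≟ v ×-dec b ≟ w) + steps v w b bs) + e
      ≡⟨ cong (_+ e) (∑-+ _ _ N) ⟩
    ∑ N (λ w → 𝟙 (a ≟ v ×-dec b ≟ w)) + S + e
      ≡⟨ cong (λ x → x + S + e) out ⟩
    𝟙 (a ≟ v) + S + e
      ≡⟨ +-assoc (𝟙 (a ≟ v)) S e ⟩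
    𝟙 (a ≟ v) + (S + e)
      ≡⟨ cong (𝟙 (a ≟ v) +_) (steps-balance v b bs N uN cover l) ⟩
    𝟙 (a ≟ v) + (T + 𝟙 (b ≟ v))
      ≡⟨ solve 3 (λ x t y → x :+ (t :+ y) := y :+ t :+ x) refl (𝟙 (a ≟ v)) T (𝟙 (b ≟ v)) ⟩
    𝟙 (b ≟ v) + T + 𝟙 (a ≟ v)
      ≡⟨ cong (λ x → x + T + 𝟙 (a ≟ v)) inn ⟨
    ∑ N (λ w → 𝟙 (a ≟ w ×-dec b ≟ v)) + T + 𝟙 (a ≟ v)
      ≡⟨ cong (_+ 𝟙 (a ≟ v)) (∑-+ _ _ N) ⟨
    ∑ N (λ w → 𝟙 (a ≟ w ×-dec b ≟ v) + steps w v b bs) + 𝟙 (a ≟ v) ∎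
    where
    open ≡-Reasoning
    open +-*-Solver
    e = 𝟙 (endOf b bs ≟ v)
    S = ∑ N (λ w → steps v w b bs)
    T = ∑ N (λ w → steps w v b bs)
    out : ∑ N (λ w → 𝟙 (a ≟ v ×-dec b ≟ w)) ≡ 𝟙 (a ≟ v)
    out with a ≟ v
    ... | yes refl = ∑-𝟙 (λ w → yes refl ×-dec b ≟ w) N uN (cover b c) (refl , refl)
                         λ { _ (_ , refl) → refl }
    ... | no a≢v   = ∑-zero _ N λ w _ → 𝟙-no (no a≢v ×-dec b ≟ w) (a≢v ∘ proj₁)
    inn : ∑ N (λ w → 𝟙 (a ≟ w ×-dec b ≟ v)) ≡ 𝟙 (b ≟ v)
    inn with b ≟ v
    ... | yes refl = ∑-𝟙 (λ w → a ≟ w ×-dec yes refl) N uN (cover a (Adj-sym c)) (refl , refl)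
                         λ { _ (refl , _) → refl }
    ... | no b≢v   = ∑-zero _ N λ w _ → 𝟙-no (a ≟ w ×-dec no b≢v) (b≢v ∘ proj₂)

  module PathSystem (ps : List Path) (distinct : AllPairs (λ p q → first p ≢ first q) ps) where

    startCount endCount : V → ℕ
    startCount v = ∑ ps λ p → 𝟙 (first p ≟ v)
    endCount   v = ∑ ps λ p → 𝟙 (target p ≟ v)

    flow : V → V → ℕ
    flow v w = ∑ ps λ p → steps v w (first p) (rest p)

    starts-none : ∀ v → ¬ Source v → startCount v ≡ 0
    starts-none v ¬s = ∑-zero _ ps λ p _ → 𝟙-no (first p ≟ v) λ { refl → ¬s (source p) }

    starts-some : ∀ {p} → p ∈ ps → 1 ≤ startCount (first p)
    starts-some {p} p∈ = ≤-trans (≤-reflexive (sym (𝟙-yes (first p ≟ first p) refl)))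
                                 (∑-member (λ q → 𝟙 (first q ≟ first p)) ps p∈)

    ends-none : ∀ v → ¬ Sink v → endCount v ≡ 0
    ends-none v ¬k = ∑-zero _ ps λ p _ → 𝟙-no (target p ≟ v) λ { refl → ¬k (sink p) }

    others-apart : ∀ {p q : Path} {qs} → All (λ r → first p ≢ first r) qs → q ∈ qs → Apart p q
    others-apart {p} {q} h q∈ = apart {p} {q} (All.lookup h q∈)

    ends≤1 : ∀ v → endCount v ≤ 1
    ends≤1 v = go ps distinct
      where
      go : ∀ ps → AllPairs (λ p q → first p ≢ first q) ps → ∑ ps (λ p → 𝟙 (target p ≟ v)) ≤ 1
      go []       _       = z≤n
      go (p ∷ ps) (h ∷ d) with target p ≟ v
      ... | no _     = go ps d
      ... | yes refl = s≤s (≤-reflexive (∑-zero _ ps λ q q∈ → 𝟙-no (target q ≟ v) λ e →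
        others-apart {p} {q} h q∈ (endOf-∈ (first p) (rest p))
          (subst (_∈ visited q) e (endOf-∈ (first q) (rest q)))))

    -- By disjointness `v` lies on at most one path, so a single summand survives and `steps-bound`
    -- applies.
    flow-bound : ∀ v w → flow v w + flow w v ≤ G v w
    flow-bound v w = go ps distinct
      where
      go : ∀ ps → AllPairs (λ p q → first p ≢ first q) ps →
           ∑ ps (λ p → steps v w (first p) (rest p)) + ∑ ps (λ p → steps w v (first p) (rest p)) ≤ G v w
      go []       _       = z≤n
      go (p ∷ ps) (h ∷ d) with v ∈? visited p
      ... | yes v∈
        rewrite ∑-zero (λ q → steps v w (first q) (rest q)) ps
                  (λ q q∈ → steps-absentˡ v w _ _ (others-apart {p} {q} h q∈ v∈))
              | ∑-zero (λ q → steps w v (first q) (rest q)) ps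
                  (λ q q∈ → steps-absentʳ w v _ _ (others-apart {p} {q} h q∈ v∈))
              | +-identityʳ (steps v w (first p) (rest p))
              | +-identityʳ (steps w v (first p) (rest p))
              = steps-bound v w (first p) (rest p) (linked p) (simple p)
      ... | no v∉
        rewrite steps-absentˡ v w (first p) (rest p) v∉
              | steps-absentʳ w v (first p) (rest p) v∉ = go ps d

    flow-balance : ∀ v N → Unique N → (∀ w → Adj v w → w ∈ N) →
                   ∑ N (flow v) + endCount v ≡ ∑ N (λ w → flow w v) + startCount v
    flow-balance v N uN cover = begin
      ∑ N (flow v) + endCount v
        ≡⟨ cong (_+ endCount v) (∑-swap (λ w p → steps v w (first p) (rest p)) N ps) ⟩
      ∑ ps (λ p → ∑ N (λ w → steps v w (first p) (rest p))) + endCount v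
        ≡⟨ ∑-+ _ _ ps ⟨
      ∑ ps (λ p → ∑ N (λ w → steps v w (first p) (rest p)) + 𝟙 (target p ≟ v))
        ≡⟨ ∑-cong ps (λ p → steps-balance v (first p) (rest p) N uN cover (linked p)) ⟩
      ∑ ps (λ p → ∑ N (λ w → steps w v (first p) (rest p)) + 𝟙 (first p ≟ v))
        ≡⟨ ∑-+ _ _ ps ⟩
      ∑ ps (λ p → ∑ N (λ w → steps w v (first p) (rest p))) + startCount v
        ≡⟨ cong (_+ startCount v) (∑-swap (λ w p → steps w v (first p) (rest p)) N ps) ⟨
      ∑ N (λ w → flow w v) + startCount v ∎
      where open ≡-Reasoning

    -- 2 for an edge traversed from v to w, 0 for one traversed from w to v, and 1
    -- for an edge of a closed path.
    W : V → V → ℕ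
    W v w = (G v w ∸ (flow v w + flow w v)) + 2 * flow v w

    -- The truncated subtraction is exact by `flow-bound`; this form without subtraction is the
    -- basis of all later sums of `W`.
    W-flow : ∀ v w → W v w + flow w v ≡ G v w + flow v w
    W-flow v w = trans
      (solve 3 (λ g x y → g :+ con 2 :* x :+ y := g :+ (x :+ y) :+ x) refl
         (G v w ∸ (flow v w + flow w v)) (flow v w) (flow w v))
      (cong (_+ flow v w) (m∸n+n≡m (flow-bound v w)))
      where open +-*-Solver

    W+W : ∀ v w → W v w + W w v ≡ 2 * G v w
    W+W v w = +-cancelʳ-≡ (flow w v + flow v w) _ _ (begin
      W v w + W w v + (flow w v + flow v w)
        ≡⟨ swap-middle (W v w) _ _ _ ⟩
      W v w + flow w v + (W w v + flow v w)
        ≡⟨ cong₂ _+_ (W-flow v w) (trans (W-flow w v) (cong (_+ flow w v) (G-sym w v))) ⟩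
      G v w + flow v w + (G v w + flow w v)
        ≡⟨ solve 3 (λ g x y → g :+ x :+ (g :+ y) := con 2 :* g :+ (y :+ x)) refl
             (G v w) (flow v w) (flow w v) ⟩
      2 * G v w + (flow w v + flow v w) ∎)
      where
      open ≡-Reasoning
      open +-*-Solver

    module _ (v : V) (N : List V) (uN : Unique N) (cover : ∀ w → Adj v w → w ∈ N) where

      open ≡-Reasoning
      open +-*-Solver

      out-weight : ∑ N (W v) + endCount v ≡ ∑ N (G v) + startCount v
      out-weight = +-cancelʳ-≡ (∑ N (λ w → flow w v)) _ _ (begin
        ∑ N (W v) + endCount v + I
          ≡⟨ solve 3 (λ w e i → w :+ e :+ i := w :+ i :+ e) refl (∑ N (W v)) (endCount v) I ⟩
        ∑ N (W v) + I + endCount v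
          ≡⟨ cong (_+ endCount v) (∑-+ (W v) (λ w → flow w v) N) ⟨
        ∑ N (λ w → W v w + flow w v) + endCount v
          ≡⟨ cong (_+ endCount v) (∑-cong N (W-flow v)) ⟩
        ∑ N (λ w → G v w + flow v w) + endCount v
          ≡⟨ cong (_+ endCount v) (∑-+ (G v) (flow v) N) ⟩
        ∑ N (G v) + O + endCount v
          ≡⟨ +-assoc (∑ N (G v)) O (endCount v) ⟩
        ∑ N (G v) + (O + endCount v)
          ≡⟨ cong (∑ N (G v) +_) (flow-balance v N uN cover) ⟩
        ∑ N (G v) + (I + startCount v)
          ≡⟨ solve 3 (λ w e i → w :+ (i :+ e) := w :+ e :+ i) refl (∑ N (G v)) (startCount v) I ⟩
        ∑ N (G v) + startCount v + I ∎)
        where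
        I = ∑ N (λ w → flow w v)
        O = ∑ N (flow v)

      in-weight : ∑ N (λ w → W w v) + startCount v ≡ ∑ N (G v) + endCount v
      in-weight = +-cancelˡ-≡ (∑ N (W v) + endCount v) _ _ (begin
        ∑ N (W v) + endCount v + (∑ N (λ w → W w v) + startCount v)
          ≡⟨ swap-middle (∑ N (W v)) _ _ _ ⟩
        ∑ N (W v) + ∑ N (λ w → W w v) + (endCount v + startCount v)
          ≡⟨ cong (_+ (endCount v + startCount v)) (∑-+ (W v) (λ w → W w v) N) ⟨
        ∑ N (λ w → W v w + W w v) + (endCount v + startCount v)
          ≡⟨ cong (_+ (endCount v + startCount v)) (∑-cong N λ w →
               trans (W+W v w) (cong (G v w +_) (+-identityʳ _))) ⟩
        ∑ N (λ w → G v w + G v w) + (endCount v + startCount v)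
          ≡⟨ cong (_+ (endCount v + startCount v)) (∑-+ (G v) (G v) N) ⟩
        ∑ N (G v) + ∑ N (G v) + (endCount v + startCount v)
          ≡⟨ solve 3 (λ g e s → g :+ g :+ (e :+ s) := g :+ s :+ (g :+ e)) refl
               (∑ N (G v)) (endCount v) (startCount v) ⟩
        ∑ N (G v) + startCount v + (∑ N (G v) + endCount v)
          ≡⟨ cong (_+ (∑ N (G v) + endCount v)) out-weight ⟨
        ∑ N (W v) + endCount v + (∑ N (G v) + endCount v) ∎)

-- Edges, multiplicities and degrees

joins? : ∀ v w e → Dec (Joins v w e)
joins? v w e = List.≡-dec _≟ⱽ_ (ends e) (v ∷ w ∷ []) ⊎-dec
               List.≡-dec _≟ⱽ_ (ends e) (w ∷ v ∷ [])

joins-sym : ∀ {v w} e → Joins v w e → Joins w v e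
joins-sym e (inj₁ p) = inj₂ p
joins-sym e (inj₂ p) = inj₁ p

halfEdge? : ∀ v e → Dec (ends e ≡ v ∷ [])
halfEdge? v e = List.≡-dec _≟ⱽ_ (ends e) (v ∷ [])

data Step (v w : Vertex) (e : Edge) : Set where
  right : w ≡ (suc (proj₁ v) , proj₂ v) → e ≡ rightOf v → Step v w e
  left  : v ≡ (suc (proj₁ w) , proj₂ w) → e ≡ rightOf w → Step v w e
  up    : w ≡ (proj₁ v , suc (proj₂ v)) → e ≡ below w → Step v w e
  down  : v ≡ (proj₁ w , suc (proj₂ w)) → e ≡ below v → Step v w e

step : ∀ {v w} e → Joins v w e → Step v w e
step (rightOf _)         (inj₁ refl) = right refl refl
step (rightOf _)         (inj₂ refl) = left refl refl
step (below (_ , suc _)) (inj₁ refl) = down refl refl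
step (below (_ , suc _)) (inj₂ refl) = up refl refl
step (below (_ , zero))  (inj₁ ())
step (below (_ , zero))  (inj₂ ())

step-unique : ∀ {v w e e′} → Step v w e → Step v w e′ → e ≡ e′
step-unique (right refl refl) (right _ refl) = refl
step-unique (left refl refl)  (left _ refl)  = refl
step-unique (up refl refl)    (up _ refl)    = refl
step-unique (down refl refl)  (down _ refl)  = refl
step-unique (right refl _) (left () _)
step-unique (right refl _) (up () _)
step-unique (right refl _) (down () _)
step-unique (left refl _)  (right () _)
step-unique (left refl _)  (up () _)
step-unique (left refl _)  (down () _)
step-unique (up refl _)    (right () _)
step-unique (up refl _)    (left () _)
step-unique (up refl _)    (down () _)
step-unique (down refl _)  (right () _)
step-unique (down refl _)  (left () _)
step-unique (down refl _)  (up () _)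

joins-unique : ∀ {v w} e e′ → Joins v w e → Joins v w e′ → e ≡ e′
joins-unique e e′ p q = step-unique (step e p) (step e′ q)

joins-other : ∀ {v w w′} e → Joins v w e → Joins v w′ e → w ≡ w′
joins-other e p q with step e p | step e q
... | right refl refl | right refl _ = refl
... | right refl refl | left () refl
... | left refl refl  | right _ ()
... | left refl refl  | left refl refl = refl
... | up refl refl    | up refl refl = refl
... | up refl refl    | down _ ()
... | down refl refl  | up () refl
... | down refl refl  | down refl refl = refl

other-end : ∀ v e → v ∈ ends e → ends e ≡ v ∷ [] ⊎ ∃[ w ] Joins v w e
other-end v (rightOf _)         (here refl)         = inj₂ (_ , inj₁ refl)
other-end v (rightOf _)         (there (here refl)) = inj₂ (_ , inj₂ refl)
other-end v (below (_ , zero))  (here refl)         = inj₁ refl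
other-end v (below (_ , suc _)) (here refl)         = inj₂ (_ , inj₁ refl)
other-end v (below (_ , suc _)) (there (here refl)) = inj₂ (_ , inj₂ refl)

joins-∈ : ∀ {v w} e → Joins v w e → v ∈ ends e
joins-∈ e (inj₁ eq) rewrite eq = here refl
joins-∈ e (inj₂ eq) rewrite eq = there (here refl)

length-filter-∑ : ∀ {A : Set} {P : A → Set} (P? : ∀ x → Dec (P x)) xs →
                  length (filter P? xs) ≡ ∑ xs (λ x → 𝟙 (P? x))
length-filter-∑ P? []       = refl
length-filter-∑ P? (x ∷ xs) with P? x
... | yes _ = cong suc (length-filter-∑ P? xs)
... | no _  = length-filter-∑ P? xs

∑-𝟙≤1 : ∀ {A : Set} {P : A → Set} (P? : ∀ x → Dec (P x)) xs → Unique xs →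
        (∀ x y → P x → P y → x ≡ y) → ∑ xs (λ x → 𝟙 (P? x)) ≤ 1
∑-𝟙≤1 P? []       _        h = z≤n
∑-𝟙≤1 P? (x ∷ xs) (x∉ ∷ u) h with P? x
... | no _  = ∑-𝟙≤1 P? xs u h
... | yes p = s≤s (≤-reflexive (∑-zero _ xs λ y y∈ → 𝟙-no (P? y) λ q → All.lookup x∉ y∈ (h x y p q)))

∑-𝟙-∃ : ∀ {A : Set} {P : A → Set} (P? : ∀ x → Dec (P x)) xs →
        1 ≤ ∑ xs (λ x → 𝟙 (P? x)) → ∃[ x ] (x ∈ xs × P x)
∑-𝟙-∃ P? (x ∷ xs) le with P? x
... | yes p = x , here refl , p
... | no _  = let (y , y∈ , q) = ∑-𝟙-∃ P? xs le in y , there y∈ , q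

∑-mono : ∀ {A : Set} {f g : A → ℕ} xs → (∀ x → f x ≤ g x) → ∑ xs f ≤ ∑ xs g
∑-mono []       h = z≤n
∑-mono (x ∷ xs) h = +-mono-≤ (h x) (∑-mono xs h)

∑-ones : ∀ {A : Set} (f : A → ℕ) xs → (∀ x → x ∈ xs → f x ≡ 1) → ∑ xs f ≡ length xs
∑-ones f []       h = refl
∑-ones f (x ∷ xs) h = cong₂ _+_ (h x (here refl)) (∑-ones f xs λ y → h y ∘ there)

module Multiplicity (f : EdgeSet) where

  G : Vertex → Vertex → ℕ
  G v w = ∑ f λ e → 𝟙 (joins? v w e)

  G-sym : ∀ v w → G v w ≡ G w v
  G-sym v w = ∑-cong f λ e → 𝟙-cong (joins? v w e) (joins? w v e) (joins-sym e) (joins-sym e)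

  G-member : ∀ {v w e} → e ∈ f → Joins v w e → 1 ≤ G v w
  G-member {v} {w} {e} e∈ p = ≤-trans (≤-reflexive (sym (𝟙-yes (joins? v w e) p)))
                                      (∑-member (λ e → 𝟙 (joins? v w e)) f e∈)

  G-edge : ∀ {v w} → 1 ≤ G v w → ∃[ e ] (e ∈ f × Joins v w e)
  G-edge {v} {w} = ∑-𝟙-∃ (joins? v w) f

  halves : Vertex → ℕ
  halves v = ∑ f λ e → 𝟙 (halfEdge? v e)

  module _ (v : Vertex) (N : List Vertex) (uN : Unique N) (cover : ∀ w → 1 ≤ G v w → w ∈ N) where

    -- An edge at `v` either leads to exactly one neighbour or is a half-edge hanging from `v`.
    degree-split : degree f v ≡ ∑ N (G v) + halves v
    degree-split = begin
      degree f v
        ≡⟨ length-filter-∑ (λ e → v ∈ⱽ? ends e) f ⟩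
      ∑ f (λ e → 𝟙 (v ∈ⱽ? ends e))
        ≡⟨ pointwise f (λ e∈ → e∈) ⟩
      ∑ f (λ e → ∑ N (λ w → 𝟙 (joins? v w e)) + 𝟙 (halfEdge? v e))
        ≡⟨ ∑-+ _ _ f ⟩
      ∑ f (λ e → ∑ N (λ w → 𝟙 (joins? v w e))) + halves v
        ≡⟨ cong (_+ halves v) (∑-swap (λ w e → 𝟙 (joins? v w e)) N f) ⟨
      ∑ N (G v) + halves v ∎
      where
      open ≡-Reasoning
      no-half : ∀ e {w} → Joins v w e → ends e ≢ v ∷ []
      no-half e (inj₁ p) q with () ← trans (sym p) q
      no-half e (inj₂ p) q with () ← trans (sym p) q
      at : ∀ e → e ∈ f → 𝟙 (v ∈ⱽ? ends e) ≡ ∑ N (λ w → 𝟙 (joins? v w e)) + 𝟙 (halfEdge? v e)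
      at e e∈ with v ∈ⱽ? ends e
      ... | no v∉ = sym (cong₂ _+_
              (∑-zero _ N λ w _ → 𝟙-no (joins? v w e) (v∉ ∘ joins-∈ e))
              (𝟙-no (halfEdge? v e) λ eq → v∉ (subst (v ∈_) (sym eq) (here refl))))
      ... | yes v∈ with other-end v e v∈
      ...   | inj₁ half = sym (cong₂ _+_
                (∑-zero _ N λ w _ → 𝟙-no (joins? v w e) λ p → no-half e p half)
                (𝟙-yes (halfEdge? v e) half))
      ...   | inj₂ (w , p) = sym (cong₂ _+_
                (∑-𝟙 (λ w → joins? v w e) N uN (cover w (G-member e∈ p)) p λ w′ q → joins-other e q p)
                (𝟙-no (halfEdge? v e) (no-half e p)))
      pointwise : ∀ es → (∀ {e} → e ∈ es → e ∈ f) →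
        ∑ es (λ e → 𝟙 (v ∈ⱽ? ends e)) ≡ ∑ es (λ e → ∑ N (λ w → 𝟙 (joins? v w e)) + 𝟙 (halfEdge? v e))
      pointwise []       h = refl
      pointwise (e ∷ es) h = cong₂ _+_ (at e (h (here refl))) (pointwise es (h ∘ there))

    -- Turns degrees into the form that `PathFlow` asks for: too many distinct neighbours would
    -- exceed the degree.
    neighbours≤ : ∀ us → Unique us → All (λ u → 1 ≤ G v u) us → length us ≤ ∑ N (G v)
    neighbours≤ us uus adj = begin
      length us
        ≡⟨ ∑-ones _ us (λ u u∈ → ∑-𝟙 (λ w → u ≟ⱽ w) N uN (cover u (All.lookup adj u∈)) refl λ _ → sym) ⟨
      ∑ us (λ u → ∑ N (λ w → 𝟙 (u ≟ⱽ w)))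
        ≡⟨ ∑-swap (λ u w → 𝟙 (u ≟ⱽ w)) us N ⟩
      ∑ N (λ w → ∑ us (λ u → 𝟙 (u ≟ⱽ w)))
        ≤⟨ ∑-mono N at ⟩
      ∑ N (G v) ∎
      where
      open ≤-Reasoning
      at : ∀ w → ∑ us (λ u → 𝟙 (u ≟ⱽ w)) ≤ G v w
      at w with w ∈ⱽ? us
      ... | yes w∈ = ≤-trans (≤-reflexive (∑-𝟙 (λ u → u ≟ⱽ w) us uus w∈ refl λ _ p → p))
                             (All.lookup adj w∈)
      ... | no w∉  = ≤-trans (≤-reflexive (∑-zero _ us λ u u∈ → 𝟙-no (u ≟ⱽ w) λ { refl → w∉ u∈ })) z≤n

-- Row coordinates

-- With this recursion `E y (suc z)` is the right neighbour of `O y z` by computation.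
dbl : ℕ → ℕ
dbl zero    = 0
dbl (suc z) = suc (suc (dbl z))

dbl≡2* : ∀ z → dbl z ≡ 2 * z
dbl≡2* zero    = refl
dbl≡2* (suc z) = trans (cong (suc ∘ suc) (dbl≡2* z)) (cong suc (sym (+-suc z (z + 0))))

-- The even and the odd vertices of row k (those with coordinate sum 2k and
-- 2k + 1, respectively) are E y z and O y z for y + z = k. Row k contains
-- the left boundary vertex E k 0 and the foot E 0 k.
E O : ℕ → ℕ → Vertex
E y z = dbl z + y , y
O y z = suc (dbl z + y) , y

evenNbrs oddNbrs : ℕ → ℕ → List Vertex
evenNbrs y z = O y z ∷ lower y ++ upper z
  where
  lower upper : ℕ → List Vertex
  lower zero    = []
  lower (suc y) = O y z ∷ []
  upper zero    = []
  upper (suc z) = O y z ∷ O (suc y) z ∷ []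
oddNbrs y z = E y z ∷ E y (suc z) ∷ E (suc y) z ∷ lower y
  where
  lower : ℕ → List Vertex
  lower zero    = []
  lower (suc y) = E y (suc z) ∷ []

height≢ : ∀ {x x′ y y′ : ℕ} → y ≢ y′ → (x , y) ≢ (x′ , y′)
height≢ h refl = h refl

column≢ : ∀ {x x′ y y′ : ℕ} → x ≢ x′ → (x , y) ≢ (x′ , y′)
column≢ h refl = h refl

evenNbrs-unique : ∀ y z → Unique (evenNbrs y z)
evenNbrs-unique zero    zero    = [] ∷ []
evenNbrs-unique (suc y) zero    = (height≢ 1+n≢n ∷ []) ∷ [] ∷ []
evenNbrs-unique zero    (suc z) =
  (column≢ (m+1+n≢n 1) ∷ height≢ (λ ()) ∷ []) ∷ (height≢ (λ ()) ∷ []) ∷ [] ∷ []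
evenNbrs-unique (suc y) (suc z) =
  (height≢ 1+n≢n ∷ column≢ (m+1+n≢n 1) ∷ height≢ (1+n≢n ∘ sym) ∷ [])
  ∷ (height≢ (1+n≢n ∘ sym) ∷ height≢ (m+1+n≢n 1 ∘ sym) ∷ []) ∷ (height≢ (1+n≢n ∘ sym) ∷ []) ∷ [] ∷ []

oddNbrs-unique : ∀ y z → Unique (oddNbrs y z)
oddNbrs-unique zero    z = (column≢ (m+1+n≢n 1 ∘ sym) ∷ height≢ (λ ()) ∷ [])
  ∷ (height≢ (λ ()) ∷ []) ∷ [] ∷ []
oddNbrs-unique (suc y) z =
  (column≢ (m+1+n≢n 1 ∘ sym) ∷ height≢ (1+n≢n ∘ sym) ∷ height≢ 1+n≢n ∷ [])
  ∷ (height≢ (1+n≢n ∘ sym) ∷ height≢ 1+n≢n ∷ []) ∷ (height≢ (m+1+n≢n 1) ∷ []) ∷ [] ∷ []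

-- On the left boundary, `z = 0`, a step left or up would leave the triangle.
evenNbrs-cover : ∀ {n} y z {w e} → Step (E y z) w e → InTriangle n w → w ∈ evenNbrs y z
evenNbrs-cover y       z       (right refl _) _       = here refl
evenNbrs-cover y       zero    (left refl _)  (h , _) = contradiction h (<-irrefl refl)
evenNbrs-cover zero    (suc z) {x , _} (left eq _) _ with refl ← cong proj₂ eq =
  there (here (cong (_, 0) (sym (suc-injective (cong proj₁ eq)))))
evenNbrs-cover (suc y) (suc z) {x , _} (left eq _) _ with refl ← cong proj₂ eq =
  there (there (here (cong (_, suc y) (sym (suc-injective (cong proj₁ eq))))))
evenNbrs-cover y       zero    (up refl _)    (h , _) = contradiction h (<-irrefl refl)
evenNbrs-cover zero    (suc z) (up refl _)    _       =
  there (there (here (cong (λ x → suc x , 1) (sym (+-suc (dbl z) 0)))))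
evenNbrs-cover (suc y) (suc z) (up refl _)    _       =
  there (there (there (here (cong (λ x → suc x , 2 + y) (sym (+-suc (dbl z) (suc y)))))))
evenNbrs-cover zero    z       (down () _)    _
evenNbrs-cover (suc y) z {x , _} (down eq _) _ with refl ← cong proj₁ eq | refl ← cong proj₂ eq =
  there (here (cong (_, y) (+-suc (dbl z) y)))

oddNbrs-cover : ∀ y z {w e} → Step (O y z) w e → w ∈ oddNbrs y z
oddNbrs-cover y       z (right refl _) = there (here refl)
oddNbrs-cover y       z (left refl _)  = here refl
oddNbrs-cover y       z (up refl _)    = there (there (here (cong (_, suc y) (sym (+-suc (dbl z) y)))))
oddNbrs-cover zero    z (down () _)
oddNbrs-cover (suc y) z {x , _} (down eq _) with refl ← cong proj₁ eq | refl ← cong proj₂ eq =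
  there (there (there (here (cong (λ x → suc x , y) (+-suc (dbl z) y)))))

-- Sublists

sublists-⊆ : ∀ {A : Set} (xs : List A) {ys y} → ys ∈ sublists xs → y ∈ ys → y ∈ xs
sublists-⊆ []       (here refl) ()
sublists-⊆ (x ∷ xs) ys∈ y∈ with ∈-++⁻ (sublists xs) ys∈
... | inj₁ p = there (sublists-⊆ xs p y∈)
... | inj₂ p with ∈-map⁻ (x ∷_) p | y∈
...   | _ , zs∈ , refl | here refl = here refl
...   | _ , zs∈ , refl | there q   = there (sublists-⊆ xs zs∈ q)

sublists-unique : ∀ {A : Set} (xs : List A) {ys} → Unique xs → ys ∈ sublists xs → Unique ys
sublists-unique []       _        (here refl) = []
sublists-unique (x ∷ xs) (x∉ ∷ u) ys∈ with ∈-++⁻ (sublists xs) ys∈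
... | inj₁ p = sublists-unique xs u p
... | inj₂ p with ∈-map⁻ (x ∷_) p
...   | _ , zs∈ , refl =
  All.tabulate (λ y∈ → All.lookup x∉ (sublists-⊆ xs zs∈ y∈)) ∷ sublists-unique xs u zs∈

-- Every opening parenthesis is matched

-- The invariant of the scan: no closing parenthesis meets an empty stack, and
-- the stack is empty at the end.
Balanced : List ℕ → Word → Set
Balanced st w = (∀ j → ∣ take j w ∣₁ ≤ length st + ∣ take j w ∣₀) × length st + ∣ w ∣₀ ≡ ∣ w ∣₁

balanced-0 : ∀ k st {w} → Balanced st (0F ∷ w) → Balanced (k ∷ st) w
balanced-0 k st (h , e) =
  (λ j → ≤-trans (h (suc j)) (≤-reflexive (+-suc (length st) _))) ,
  trans (sym (+-suc (length st) _)) e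

balanced-1 : ∀ i st {w} → Balanced (i ∷ st) (1F ∷ w) → Balanced st w
balanced-1 i st (h , e) = (λ j → ≤-pred (h (suc j))) , suc-injective e

-- A position stays on the stack until a letter 1 removes it, and the stack ends empty.
closes : ∀ k st w → Balanced st w → ∀ {i} → i ∈ st →
         ∃[ j ] ((i , k + j) ∈ parenthesisPairs k st w × j < length w × nth w j ≡ 1F)
closes k (_ ∷ st) []       (_ , ()) i∈
closes k st       (0F ∷ w) b {i}    i∈ =
  let (j , p , j< , e) = closes (suc k) (k ∷ st) w (balanced-0 k st b) (there i∈) in
  suc j , subst (λ x → (i , x) ∈ parenthesisPairs k st (0F ∷ w)) (sym (+-suc k j)) p , s≤s j< , e
closes k (i ∷ st) (1F ∷ w) b        (here refl) = 0 , here (cong (i ,_) (+-identityʳ k)) , s≤s z≤n , refl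
closes k (i ∷ st) (1F ∷ w) b {i′}   (there i∈) =
  let (j , p , j< , e) = closes (suc k) st w (balanced-1 i st b) i∈ in
  suc j , there (subst (λ x → (i′ , x) ∈ parenthesisPairs (suc k) st w) (sym (+-suc k j)) p) , s≤s j< , e

-- Provides the partner of an opening foot, and thereby the path that starts there.
opens : ∀ k st w → Balanced st w → ∀ m → m < length w → nth w m ≡ 0F →
        ∃[ j ] ((k + m , k + j) ∈ parenthesisPairs k st w × m < j × j < length w × nth w j ≡ 1F)
opens k st       (0F ∷ w) b zero m< e =
  let (j , p , j< , e) = closes (suc k) (k ∷ st) w (balanced-0 k st b) (here refl) in
  suc j , subst₂ (λ x y → (x , y) ∈ parenthesisPairs k st (0F ∷ w))
                 (sym (+-identityʳ k)) (sym (+-suc k j)) p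
        , s≤s z≤n , s≤s j< , e
opens k st       (0F ∷ w) b (suc m) (s≤s m<) e =
  let (j , p , m<j , j< , e) = opens (suc k) (k ∷ st) w (balanced-0 k st b) m m< e in
  suc j , subst₂ (λ x y → (x , y) ∈ parenthesisPairs k st (0F ∷ w))
                 (sym (+-suc k m)) (sym (+-suc k j)) p
        , s≤s m<j , s≤s j< , e
opens k []       (1F ∷ w) (h , _) (suc m) m< e with () ← h 1
opens k (i ∷ st) (1F ∷ w) b (suc m) (s≤s m<) e =
  let (j , p , m<j , j< , e) = opens (suc k) st w (balanced-1 i st b) m m< e in
  suc j , there (subst₂ (λ x y → (x , y) ∈ parenthesisPairs (suc k) st w)
                        (sym (+-suc k m)) (sym (+-suc k j)) p)
        , s≤s m<j , s≤s j< , e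

-- The triangle in row coordinates

module Triangle (n : ℕ) (1≤n : 1 ≤ n) where

  -- Coordinate sums are at most 2M, so even vertices fill the rows 0 to M and odd ones the rows 0
  -- to M - 1.
  M : ℕ
  M = 2 * n ∸ 1

  suc-M : suc M ≡ 2 * n
  suc-M = m+[n∸m]≡n (≤-trans 1≤n (m≤m+n n _))

  4n : 4 * n ≡ suc (suc (M + M))
  4n = begin
    4 * n           ≡⟨ solve 1 (λ n → con 4 :* n := con 2 :* n :+ con 2 :* n) refl n ⟩
    2 * n + 2 * n   ≡⟨ cong₂ _+_ suc-M suc-M ⟨
    suc M + suc M   ≡⟨ cong suc (+-suc M M) ⟩
    suc (suc (M + M)) ∎
    where
    open ≡-Reasoning
    open +-*-Solver

  4n∸2 : 4 * n ∸ 2 ≡ M + M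
  4n∸2 = cong (_∸ 2) 4n

  1≤M : 1 ≤ M
  1≤M = ≤-pred (≤-trans (*-monoʳ-≤ 2 1≤n) (≤-reflexive (sym suc-M)))

  E-total : ∀ y z → dbl z + y + y ≡ (y + z) + (y + z)
  E-total y z = trans (cong (λ x → x + y + y) (dbl≡2* z))
    (solve 2 (λ y z → con 2 :* z :+ y :+ y := (y :+ z) :+ (y :+ z)) refl y z)
    where open +-*-Solver

  halve : ∀ {a b} → a + a ≤ b + b → a ≤ b
  halve {a} {b} h = *-cancelˡ-≤ 2 (≤-trans (≤-reflexive (cong (a +_) (+-identityʳ a)))
    (≤-trans h (≤-reflexive (cong (b +_) (sym (+-identityʳ b))))))

  E-inside : ∀ {y z} → y + z ≤ M → InTriangle n (E y z)
  E-inside {y} {z} h = m≤n+m y (dbl z) ,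
    ≤-trans (≤-reflexive (E-total y z)) (≤-trans (+-mono-≤ h h) (≤-reflexive (sym 4n∸2)))

  E-outside : ∀ {y z} → InTriangle n (E y z) → y + z ≤ M
  E-outside {y} {z} (_ , h) = halve (≤-trans (≤-reflexive (sym (E-total y z)))
                                            (≤-trans h (≤-reflexive 4n∸2)))

  O-inside : ∀ {y z} → y + z < M → InTriangle n (O y z)
  O-inside {y} {z} h = m≤n⇒m≤1+n (m≤n+m y (dbl z)) ,
    ≤-trans (s≤s (≤-reflexive (E-total y z)))
      (≤-trans (+-mono-≤ h (<⇒≤ h)) (≤-reflexive (sym 4n∸2)))

  O-outside : ∀ {y z} → InTriangle n (O y z) → y + z < M
  O-outside {y} {z} (_ , h) = ≰⇒> λ M≤ → <-irrefl refl (≤-trans (s≤s (+-mono-≤ M≤ M≤))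
    (≤-trans (s≤s (≤-reflexive (sym (E-total y z)))) (≤-trans h (≤-reflexive 4n∸2))))

  vertices-unique : Unique (vertices n)
  vertices-unique = Unique.filter⁺ (inTriangle? n)
    (Unique.cartesianProduct⁺ (Unique.upTo⁺ (4 * n)) (Unique.upTo⁺ (4 * n)))

  vertices-complete : ∀ {v} → InTriangle n v → v ∈ vertices n
  vertices-complete {x , y} h = ∈-filter⁺ (inTriangle? n)
    (∈-cartesianProduct⁺ (∈-upTo⁺ (≤-<-trans (m≤m+n x y) sum<))
                          (∈-upTo⁺ (≤-<-trans (m≤n+m y x) sum<))) h
    where
    sum< : x + y < 4 * n
    sum< = ≤-<-trans (proj₂ h) (≤-trans (s≤s (≤-reflexive 4n∸2))
                                   (≤-trans (n≤1+n _) (≤-reflexive (sym 4n))))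

  rightEdges belowEdges externalEdges : List Edge
  rightEdges    = filter (λ e → all? (inTriangle? n) (ends e)) (map rightOf (vertices n))
  belowEdges    = map below (filter (λ v → 1 ≤? proj₂ v) (vertices n))
  externalEdges = map (external {n}) (allFin (2 * n))

  data EdgeView : Edge → Set where
    right : ∀ {v} → All (InTriangle n) (ends (rightOf v)) → EdgeView (rightOf v)
    down  : ∀ {x y} → InTriangle n (x , suc y) → EdgeView (below (x , suc y))
    ext   : ∀ i → EdgeView (external {n} i)

  edgeView : ∀ {e} → e ∈ edges n → EdgeView e
  edgeView e∈ with ∈-++⁻ rightEdges e∈
  edgeView e∈ | inj₁ p
    with q , h ← ∈-filter⁻ (λ e → all? (inTriangle? n) (ends e)) {xs = map rightOf (vertices n)} p
    with _ , _ , refl ← ∈-map⁻ rightOf q = right h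
  edgeView e∈ | inj₂ p with ∈-++⁻ belowEdges p
  ... | inj₂ q with i , _ , refl ← ∈-map⁻ (external {n}) q = ext i
  ... | inj₁ q
    with (x , y) , q , refl ← ∈-map⁻ below q
    with v∈ , s≤s _ ← ∈-filter⁻ (λ v → 1 ≤? proj₂ v) {xs = vertices n} q =
    down (proj₂ (∈-filter⁻ (inTriangle? n) {xs = cartesianProduct (upTo (4 * n)) (upTo (4 * n))} v∈))

  edges-unique : Unique (edges n)
  edges-unique = Unique.++⁺
    (Unique.filter⁺ (λ e → all? (inTriangle? n) (ends e))
      (Unique.map⁺ (λ { refl → refl }) vertices-unique))
    (Unique.++⁺
      (Unique.map⁺ (λ { refl → refl }) (Unique.filter⁺ (λ v → 1 ≤? proj₂ v) vertices-unique))
      (Unique.map⁺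
        (λ {i} {j} e → Fin.toℕ-injective (*-cancelˡ-≡ (toℕ i) (toℕ j) 2 (foot-injective e)))
        (Unique.allFin⁺ (2 * n)))
      disjoint₂)
    disjoint₁
    where
    foot-injective : ∀ {x y} → below (x , 0) ≡ below (y , 0) → x ≡ y
    foot-injective refl = refl
    disjoint₂ : ∀ {e} → ¬ (e ∈ belowEdges × e ∈ externalEdges)
    disjoint₂ (p , q) with ∈-map⁻ below p | ∈-map⁻ (external {n}) q
    ... | _ , r , refl | _ , _ , refl with ∈-filter⁻ (λ v → 1 ≤? proj₂ v) {xs = vertices n} r
    ...   | _ , ()
    disjoint₁ : ∀ {e} → ¬ (e ∈ rightEdges × e ∈ belowEdges ++ externalEdges)
    disjoint₁ (p , q)
      with p′ , _ ← ∈-filter⁻ (λ e → all? (inTriangle? n) (ends e)) {xs = map rightOf (vertices n)} p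
      with ∈-map⁻ rightOf p′ | ∈-++⁻ belowEdges q
    ... | _ , _ , refl | inj₁ q′ with () ← proj₂ (proj₂ (∈-map⁻ below q′))
    ... | _ , _ , refl | inj₂ q′ with () ← proj₂ (proj₂ (∈-map⁻ (external {n}) q′))

  edges-inside : ∀ {v w e} → e ∈ edges n → Joins v w e → InTriangle n w
  edges-inside e∈ j with edgeView e∈
  edges-inside e∈ (inj₁ refl) | right (_ ∷ h ∷ _) = h
  edges-inside e∈ (inj₂ refl) | right (h ∷ _)     = h
  edges-inside e∈ (inj₁ refl) | down {x} {y} (h , h′) =
    <⇒≤ h , ≤-trans (+-monoʳ-≤ x (n≤1+n y)) h′
  edges-inside e∈ (inj₂ refl) | down h            = h
  edges-inside e∈ (inj₁ ())   | ext i
  edges-inside e∈ (inj₂ ())   | ext i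

  edges-half : ∀ {v e} → e ∈ edges n → ends e ≡ v ∷ [] → ∃[ i ] v ≡ foot {n} i
  edges-half e∈ h with edgeView e∈ | h
  ... | right _ | ()
  ... | down _  | ()
  ... | ext i   | refl = i , refl

  parity : ∀ {x y} → y ≤ x → ∃[ z ] ((x , y) ≡ E y z ⊎ (x , y) ≡ O y z)
  parity {x} {y} h with go (x ∸ y)
    where
    go : ∀ d → ∃[ z ] (d ≡ dbl z ⊎ d ≡ suc (dbl z))
    go zero    = 0 , inj₁ refl
    go (suc d) with go d
    ... | z , inj₁ refl = z , inj₂ refl
    ... | z , inj₂ refl = suc z , inj₁ refl
  ... | z , inj₁ e = z , inj₁ (cong (_, y) (trans (sym (m∸n+n≡m h)) (cong (_+ y) e)))
  ... | z , inj₂ e = z , inj₂ (cong (_, y) (trans (sym (m∸n+n≡m h)) (cong (_+ y) e)))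

  E-injective : ∀ {y z y′ z′} → E y z ≡ E y′ z′ → y ≡ y′ × z ≡ z′
  E-injective {y} {z} {y′} {z′} e with refl ← cong proj₂ e =
    refl , *-cancelˡ-≡ z z′ 2 (trans (sym (dbl≡2* z)) (trans (+-cancelʳ-≡ y _ _ (cong proj₁ e)) (dbl≡2* z′)))

  E≢O : ∀ {y z y′ z′} → E y z ≢ O y′ z′
  E≢O {y} {z} {y′} {z′} e with refl ← cong proj₂ e = go z z′ (+-cancelʳ-≡ y _ _ (cong proj₁ e))
    where
    go : ∀ z z′ → dbl z ≢ suc (dbl z′)
    go (suc z) (suc z′) e = go z z′ (suc-injective (suc-injective e))

  L≡E : ∀ {y} i → toℕ i ≡ y → L {n} i ≡ E y 0
  L≡E i refl = refl

  R≡E : ∀ {y z} i → toℕ i ≡ z → y + z ≡ M → R {n} i ≡ E y z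
  R≡E {y} {z} i refl e = cong₂ _,_ column height
    where
    column : 2 * n ∸ 2 + suc z ≡ dbl z + y
    column = begin
      2 * n ∸ 2 + suc z   ≡⟨ cong (λ x → x ∸ 2 + suc z) suc-M ⟨
      M ∸ 1 + suc z       ≡⟨ +-suc (M ∸ 1) z ⟩
      suc (M ∸ 1) + z     ≡⟨ cong (_+ z) (m+[n∸m]≡n 1≤M) ⟩
      M + z               ≡⟨ cong (_+ z) e ⟨
      y + z + z           ≡⟨ solve 2 (λ y z → y :+ z :+ z := con 2 :* z :+ y) refl y z ⟩
      2 * z + y           ≡⟨ cong (_+ y) (dbl≡2* z) ⟨
      dbl z + y           ∎
      where
      open ≡-Reasoning
      open +-*-Solver
    height : 2 * n ∸ suc z ≡ y
    height = trans (cong (_∸ suc z) (sym suc-M)) (trans (cong (_∸ z) (sym e)) (m+n∸n≡m y z))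

  foot≡E : ∀ {z} i → toℕ i ≡ z → foot {n} i ≡ E 0 z
  foot≡E {z} i refl = cong (_, 0) (trans (sym (dbl≡2* z)) (sym (+-identityʳ (dbl z))))

  R-row : ∀ (i : Fin (2 * n)) → M ∸ toℕ i + toℕ i ≡ M
  R-row i = m∸n+n≡m (≤-pred (≤-trans (Fin.toℕ<n i) (≤-reflexive (sym suc-M))))

  onBoundary : ∀ {y z} → OnBoundary n (E y z) → z ≡ 0 ⊎ y + z ≡ M
  onBoundary {y} {z} (i , inj₁ e) = inj₁ (proj₂ (E-injective {y} {z} {toℕ i} {0} e))
  onBoundary {y} {z} (i , inj₂ e) =
    let (p , q) = E-injective {y} {z} (trans e (R≡E i refl (R-row i))) in
    inj₂ (trans (cong₂ _+_ p q) (R-row i))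

  O-notOnBoundary : ∀ {y z} → ¬ OnBoundary n (O y z)
  O-notOnBoundary {y} {z} (i , inj₁ e) = E≢O {toℕ i} {0} {y} {z} (sym e)
  O-notOnBoundary {y} {z} (i , inj₂ e) = E≢O {M ∸ toℕ i} {toℕ i} {y} {z}
    (sym (trans e (R≡E i refl (R-row i))))

-- Weights from vertex pairs, and facts on words

zeros-take : ∀ w m → m ≤ length w → ∣ take m w ∣₀ ≡ zeros (nth w) m
zeros-take w       zero    _       = refl
zeros-take (x ∷ w) (suc m) (s≤s h) =
  trans (∣∷∣₀ x (take m w)) (trans (cong (is0 x +_) (zeros-take w m h)) (sym (zeros-∷ x w m)))

ones-take : ∀ w m → m ≤ length w → ∣ take m w ∣₁ ≡ ones (nth w) m
ones-take w       zero    _       = refl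
ones-take (x ∷ w) (suc m) (s≤s h) =
  trans (∣∷∣₁ x (take m w)) (trans (cong (is1 x +_) (ones-take w m h)) (sym (ones-∷ x w m)))

-- The even end is always the first argument, so exchanging the arguments of `F` yields the weight
-- in the opposite direction.
fromEven : (Vertex → Vertex → ℕ) → Weight
fromEven F = record
  { a = λ y z → F (E y z) (O y z)
  ; c = λ y z → F (E y (suc z)) (O y z)
  ; d = λ y z → F (E y (suc z)) (O (suc y) z)
  ; u = λ y z → F (E (suc y) z) (O y z)
  }

even-sum : ∀ F y z → evenSum (fromEven F) y z ≡ ∑ (evenNbrs y z) (F (E y z))
even-sum F zero    zero    = refl
even-sum F (suc y) zero    = refl
even-sum F zero    (suc z) = cong (F (E 0 (suc z)) (O 0 (suc z)) +_)
  (cong (F (E 0 (suc z)) (O 0 z) +_) (sym (+-identityʳ _)))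
even-sum F (suc y) (suc z) = cong (F (E (suc y) (suc z)) (O (suc y) (suc z)) +_)
  (cong (F (E (suc y) (suc z)) (O y (suc z)) +_)
    (cong (F (E (suc y) (suc z)) (O (suc y) z) +_) (sym (+-identityʳ _))))

odd-sum : ∀ F y z → oddSum (fromEven F) y z ≡ ∑ (oddNbrs y z) (λ w → F w (O y z))
odd-sum F zero    z = refl
odd-sum F (suc y) z = cong (F (E (suc y) z) (O (suc y) z) +_)
  (cong (F (E (suc y) (suc z)) (O (suc y) z) +_)
    (cong (F (E (2 + y) z) (O (suc y) z) +_) (sym (+-identityʳ _))))

length-word : ∀ {n} (w : 𝒟 n) → length (word w) ≡ 2 * n
length-word w = Vec.length-toList (letters w)

first-letter : ∀ {n} → 1 ≤ n → (w : 𝒟 n) → nth (word w) 0 ≡ 0F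
first-letter {n} 1≤n w = go (word w) (length-word w) (𝒟.ballot w 1)
  where
  go : ∀ v → length v ≡ 2 * n → ∣ take 1 v ∣₁ ≤ ∣ take 1 v ∣₀ → nth v 0 ≡ 0F
  go []       e h = contradiction (≤-trans 1≤n (≤-trans (m≤m+n n _) (≤-reflexive (sym e)))) λ ()
  go (0F ∷ v) e h = refl
  go (1F ∷ v) e ()

-- Before a final 0 there would be n ones and only n - 1 zeros, against the ballot condition.
last-letter : ∀ {n m} → suc m ≡ 2 * n → (w : 𝒟 n) → nth (word w) m ≡ 1F
last-letter {n} {m} e w with nth (word w) m in eq
... | 1F = refl
... | 0F = contradiction (begin-strict
  n                            ≡⟨ 𝒟.ones w ⟨
  ∣ word w ∣₁                  ≡⟨ ones-length (word w) ⟨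
  ones f (length (word w))     ≡⟨ cong (ones f) (trans (length-word w) (sym e)) ⟩
  is1 (f m) + ones f m         ≡⟨ cong (λ x → is1 x + ones f m) eq ⟩
  ones f m                     ≡⟨ ones-take (word w) m m≤ ⟨
  ∣ take m (word w) ∣₁         ≤⟨ 𝒟.ballot w m ⟩
  ∣ take m (word w) ∣₀         ≡⟨ zeros-take (word w) m m≤ ⟩
  zeros f m                    <⟨ n<1+n _ ⟩
  suc (zeros f m)              ≡⟨ cong (λ x → is0 x + zeros f m) eq ⟨
  zeros f (suc m)              ≡⟨ cong (zeros f) (trans (length-word w) (sym e)) ⟨
  zeros f (length (word w))    ≡⟨ zeros-length (word w) ⟩
  ∣ word w ∣₀                  ≡⟨ 𝒟.zeros w ⟩
  n                            ∎) (<-irrefl refl)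
  where
  open ≤-Reasoning
  f = nth (word w)
  m≤ : m ≤ length (word w)
  m≤ = ≤-trans (n≤1+n m) (≤-reflexive (trans e (sym (length-word w))))

balanced : ∀ {n} (w : 𝒟 n) → Balanced [] (word w)
balanced w = 𝒟.ballot w , trans (𝒟.zeros w) (sym (𝒟.ones w))

letter-nth : ∀ {n} (w : 𝒟 n) i {m} → toℕ i ≡ m → letter w i ≡ nth (word w) m
letter-nth w i refl = sym (nth-toList (letters w) i)

endOf-last : ∀ {A : Set} (a : A) bs {w} → last (a ∷ bs) ≡ just w → endOf a bs ≡ w
endOf-last a []       refl = refl
endOf-last a (b ∷ bs) e    = endOf-last b bs e

0≢1 : ∀ {x : Fin 2} → x ≡ 0F → x ≢ 1F
0≢1 refl ()

-- Degrees in a configuration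

module Configuration {n : ℕ} (1≤n : 1 ≤ n) (σ τ π : 𝒟 n) (f : EdgeSet)
  (f∈ : f ∈ sublists (edges n)) (T : IsTFPL σ τ π f) where

  open Triangle n 1≤n
  open Multiplicity f
  open IsTFPL T

  σ̂ τ̂ π̂ : ℕ → Fin 2
  σ̂ = nth (word σ)
  τ̂ = nth (word τ)
  π̂ = nth (word π)

  index : ∀ {m} → m ≤ M → ∃[ i ] toℕ {2 * n} i ≡ m
  index {m} h = fromℕ< m< , Fin.toℕ-fromℕ< m<
    where
    m< : m < 2 * n
    m< = ≤-trans (s≤s h) (≤-reflexive suc-M)

  f-unique : Unique f
  f-unique = sublists-unique (edges n) edges-unique f∈

  f-edge : ∀ {e} → e ∈ f → e ∈ edges n
  f-edge = sublists-⊆ (edges n) f∈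

  G≤1 : ∀ v w → G v w ≤ 1
  G≤1 v w = ∑-𝟙≤1 (joins? v w) f f-unique λ e e′ → joins-unique e e′

  G-inside : ∀ {v w} → 1 ≤ G v w → InTriangle n w
  G-inside h = let (e , e∈ , j) = G-edge h in edges-inside (f-edge e∈) j

  G-step : ∀ {v w} → 1 ≤ G v w → ∃[ e ] (e ∈ f × Step v w e)
  G-step h = let (e , e∈ , j) = G-edge h in e , e∈ , step e j

  G-zero : ∀ {v w} → ¬ (1 ≤ G v w) → G v w ≡ 0
  G-zero h = n<1⇒n≡0 (≰⇒> h)

  even-cover : ∀ y z w → 1 ≤ G (E y z) w → w ∈ evenNbrs y z
  even-cover y z w h = let (_ , _ , q) = G-step h in evenNbrs-cover {n} y z q (G-inside h)

  odd-cover : ∀ y z w → 1 ≤ G (O y z) w → w ∈ oddNbrs y z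
  odd-cover y z w h = let (_ , _ , q) = G-step h in oddNbrs-cover y z q

  g : Weight
  g = fromEven G
  module g = Weight g

  degree-even : ∀ y z → ∑ (evenNbrs y z) (G (E y z)) ≡ evenSum g y z
  degree-even y z = sym (even-sum G y z)

  left-a : ∀ {y} → y < M → 1 ≤ g.a y 0
  left-a {y} y<M = let (i , e) = index (<⇒≤ y<M) in
    G-member (subst (λ v → rightOf v ∈ f) (L≡E i e)
                (L-right i (subst₂ _<_ (cong suc (sym e)) suc-M (s≤s y<M)))) (inj₁ refl)

  below-joins : ∀ y z → Joins (E (suc y) z) (O y z) (below (E (suc y) z))
  below-joins y z = inj₁ (cong (λ x → E (suc y) z ∷ (x , y) ∷ []) (+-suc (dbl z) y))

  u-below : ∀ {y z} → 1 ≤ g.u y z → below (E (suc y) z) ∈ f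
  u-below {y} {z} h = let (e , e∈ , j) = G-edge h in
    subst (_∈ f) (joins-unique e _ j (below-joins y z)) e∈

  left-u : ∀ {y} → suc y ≤ M → 1 ≤ g.u y 0 ⇔ σ̂ (suc y) ≡ 0F
  left-u {y} h = mk⇔
    (λ b → trans (sym (letter-nth σ i e))
      (Equivalence.to (L-below i 0<i) (subst (λ v → below v ∈ f) (sym (L≡E i e)) (u-below b))))
    (λ σ0 → G-member
      (subst (λ v → below v ∈ f) (L≡E i e)
        (Equivalence.from (L-below i 0<i) (trans (letter-nth σ i e) σ0)))
      (below-joins y 0))
    where
    i = proj₁ (index h)
    e = proj₂ (index h)
    0<i : 0 < toℕ i
    0<i = subst (0 <_) (sym e) (s≤s z≤n)

  right-u : ∀ {y z} → suc (y + z) ≡ M → 1 ≤ g.u y z ⇔ τ̂ z ≡ 1F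
  right-u {y} {z} h = mk⇔
    (λ b → trans (sym (letter-nth τ i e))
      (Equivalence.to (R-below i i<) (subst (λ v → below v ∈ f) (sym (R≡E i e h)) (u-below b))))
    (λ τ1 → G-member
      (subst (λ v → below v ∈ f) (R≡E i e h)
        (Equivalence.from (R-below i i<) (trans (letter-nth τ i e) τ1)))
      (below-joins y z))
    where
    z<M : z < M
    z<M = ≤-trans (s≤s (m≤n+m z y)) (≤-reflexive h)
    i = proj₁ (index (<⇒≤ z<M))
    e = proj₂ (index (<⇒≤ z<M))
    i< : suc (toℕ i) < 2 * n
    i< = subst₂ _<_ (cong suc (sym e)) suc-M (s≤s z<M)

  right-c : ∀ {y z} → y + suc z ≡ M → 1 ≤ g.c y z
  right-c {y} {z} h = let (i , e) = index (≤-trans (m≤n+m (suc z) y) (≤-reflexive h)) in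
    G-member (subst (λ v → leftOf v ∈ f) (R≡E i e h)
                (R-left i (subst (0 <_) (sym e) (s≤s z≤n)))) (inj₂ refl)

  degree-inner : ∀ {v} → InTriangle n v → ¬ OnBoundary n v → degree f v ≡ 2
  degree-inner h = All.lookup inner (vertices-complete h)

  no-halves : ∀ {v} → (∀ i → v ≢ foot {n} i) → halves v ≡ 0
  no-halves {v} h = ∑-zero _ f λ e e∈ → 𝟙-no (halfEdge? v e) λ q →
    let (i , eq) = edges-half (f-edge e∈) q in h i eq

  one-half : ∀ {z} → z ≤ M → halves (E 0 z) ≡ 1
  one-half {z} h = let (i , e) = index h in
    ∑-𝟙 (halfEdge? (E 0 z)) f f-unique
        (subst (λ v → below v ∈ f) (foot≡E i e) (externals i)) refl (λ e q → half-unique e q)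
    where
    half-unique : ∀ e {v} → ends e ≡ v ∷ [] → e ≡ below v
    half-unique (below (_ , zero)) refl = refl

  degree-odd : ∀ {y z} → y + z < M → ∑ (oddNbrs y z) (G (O y z)) ≡ 2
  degree-odd {y} {z} h = begin
    D                      ≡⟨ +-identityʳ D ⟨
    D + 0                  ≡⟨ cong (D +_) (no-halves λ i e → E≢O {0} {toℕ i} {y} {z}
                                (sym (trans e (foot≡E i refl)))) ⟨
    D + halves (O y z)     ≡⟨ degree-split (O y z) (oddNbrs y z) (oddNbrs-unique y z) (odd-cover y z) ⟨
    degree f (O y z)       ≡⟨ degree-inner (O-inside {y} {z} h) (O-notOnBoundary {y} {z}) ⟩
    2                      ∎
    where
    open ≡-Reasoning
    D = ∑ (oddNbrs y z) (G (O y z))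

  degree-even-split : ∀ y z → evenSum g y z + halves (E y z) ≡ degree f (E y z)
  degree-even-split y z = trans (cong (_+ halves (E y z)) (sym (degree-even y z)))
    (sym (degree-split (E y z) (evenNbrs y z) (evenNbrs-unique y z) (even-cover y z)))

  inner-even : ∀ {y z} → y + suc z < M → ¬ OnBoundary n (E y (suc z))
  inner-even {y} {z} h b with onBoundary {y} {suc z} b
  ... | inj₁ ()
  ... | inj₂ e = <-irrefl e h

  degree-interior : ∀ {y z} → suc y + suc z < M → evenSum g (suc y) (suc z) ≡ 2
  degree-interior {y} {z} h = begin
    D                                    ≡⟨ +-identityʳ D ⟨
    D + 0                                ≡⟨ cong (D +_) (no-halves λ i e → 1+n≢0 (cong proj₂ e)) ⟨
    D + halves (E (suc y) (suc z))       ≡⟨ degree-even-split (suc y) (suc z) ⟩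
    degree f (E (suc y) (suc z))         ≡⟨ degree-inner (E-inside {suc y} {suc z} (<⇒≤ h))
                                                         (inner-even {suc y} h) ⟩
    2                                    ∎
    where
    open ≡-Reasoning
    D = evenSum g (suc y) (suc z)

  -- The external edge takes one of the two places. Foot 0 is also the first left boundary vertex,
  -- where no degree is prescribed; its one edge is the horizontal one of `L-right`.
  degree-foot : ∀ {z} → z < M → evenSum g 0 z ≡ 1
  degree-foot {zero}  h = trans (+-identityʳ _) (≤-antisym (G≤1 _ _) (left-a h))
  degree-foot {suc z} h = +-cancelʳ-≡ 1 _ _ (begin
    evenSum g 0 (suc z) + 1                  ≡⟨ cong (evenSum g 0 (suc z) +_) (one-half (<⇒≤ h)) ⟨
    evenSum g 0 (suc z) + halves (E 0 (suc z)) ≡⟨ degree-even-split 0 (suc z) ⟩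
    degree f (E 0 (suc z))                   ≡⟨ degree-inner (E-inside {0} {suc z} (<⇒≤ h))
                                                             (inner-even {0} h) ⟩
    2                                        ∎)
    where open ≡-Reasoning

  degree-left : ∀ {y} → suc y < M → σ̂ (suc y) ≡ 0F → evenSum g (suc y) 0 ≡ 2
  degree-left h s0 = cong₂ _+_ (≤-antisym (G≤1 _ _) (left-a h)) (trans (+-identityʳ _)
    (≤-antisym (G≤1 _ _) (Equivalence.from (left-u (<⇒≤ h)) s0)))

  degree-left-1 : ∀ {y} → y < M → σ̂ y ≡ 1F → evenSum g y 0 ≡ 1
  degree-left-1 {zero}  h s1 = contradiction s1 (0≢1 (first-letter 1≤n σ))
  degree-left-1 {suc y} h s1 = cong₂ _+_ (≤-antisym (G≤1 _ _) (left-a h)) (trans (+-identityʳ _)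
    (G-zero λ b → 0≢1 (Equivalence.to (left-u (<⇒≤ h)) b) s1))

  degree-even≤2 : ∀ {y z} → y + z < M → evenSum g y z ≤ 2
  degree-even≤2 {zero}  {z}     h = ≤-trans (≤-reflexive (degree-foot h)) (s≤s z≤n)
  degree-even≤2 {suc y} {zero}  h = +-mono-≤ (G≤1 _ _) (≤-trans (≤-reflexive (+-identityʳ _)) (G≤1 _ _))
  degree-even≤2 {suc y} {suc z} h = ≤-reflexive (degree-interior {y} {z} h)

  right-a : ∀ {y z} → y + z ≡ M → g.a y z ≡ 0
  right-a {y} {z} h = G-zero λ b → <-irrefl h (O-outside {y} {z} (G-inside b))

  right-d : ∀ {y z} → y + suc z ≡ M → g.d y z ≡ 0
  right-d {y} {z} h = G-zero λ b → <-irrefl (trans (sym (+-suc y z)) h) (O-outside {suc y} {z} (G-inside b))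

  degree-right : ∀ y z → y + z ≡ M →
    evenSum g y z ≡ prev (λ y′ → g.u y′ z) y + prev (λ z′ → g.c y z′) z
  degree-right y zero    h = cong (_+ (prev (λ y′ → g.u y′ 0) y + 0)) (right-a h)
  degree-right y (suc z) h = cong₂ (λ a d → a + (prev (λ y′ → g.u y′ (suc z)) y + d)) (right-a h)
    (trans (cong (g.c y z +_) (right-d h)) (+-identityʳ _))

  prev≤1 : ∀ {h} k → (∀ j → h j ≤ 1) → prev h k ≤ 1
  prev≤1 zero    _ = z≤n
  prev≤1 (suc k) b = b k

  degree-right≤2 : ∀ {y z} → y + z ≡ M → evenSum g y z ≤ 2
  degree-right≤2 {y} {z} h = ≤-trans (≤-reflexive (degree-right y z h))
    (+-mono-≤ (prev≤1 y λ _ → G≤1 _ _) (prev≤1 z λ _ → G≤1 _ _))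

  degree-right-0 : ∀ {y z} → y + z ≡ M → τ̂ z ≡ 0F → evenSum g y z ≤ 1
  degree-right-0 {zero}  {z} h t0 = contradiction
    (subst (λ k → τ̂ k ≡ 1F) (sym h) (last-letter suc-M τ)) (0≢1 t0)
  degree-right-0 {suc y} {z} h t0 = ≤-trans (≤-reflexive (trans (degree-right (suc y) z h)
    (cong (_+ prev (λ z′ → g.c (suc y) z′) z) (G-zero λ b → 0≢1 t0 (Equivalence.to (right-u h) b)))))
    (prev≤1 z λ _ → G≤1 _ _)

  degree-foot≤1 : ∀ {z} → z ≤ M → evenSum g 0 z ≤ 1
  degree-foot≤1 {z} h with m≤n⇒m<n∨m≡n h
  ... | inj₁ z<M  = ≤-reflexive (degree-foot z<M)
  ... | inj₂ refl = ≤-trans (≤-reflexive (degree-right 0 z refl)) (prev≤1 z λ _ → G≤1 _ _)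

  -- Sources, sinks and the chosen paths

  -- The condition `y < M` omits the top vertex, whose path is a single point: it is only a sink.
  -- Foot 0, where σ has a letter 0, is a source through π.
  Source Sink : Vertex → Set
  Source v = (∃[ y ] (y < M × σ̂ y ≡ 1F × v ≡ E y 0))
           ⊎ (∃[ z ] (z < M × π̂ z ≡ 0F × v ≡ E 0 z))
  Sink v = (∃[ y ] ∃[ z ] (y + z ≡ M × τ̂ z ≡ 0F × v ≡ E y z))
         ⊎ (∃[ z ] (z ≤ M × π̂ z ≡ 1F × v ≡ E 0 z))

  source? : ∀ v → Dec (Source v)
  source? v = anyUpTo? (λ y → σ̂ y Fin.≟ 1F ×-dec v ≟ⱽ E y 0) M
        ⊎-dec anyUpTo? (λ z → π̂ z Fin.≟ 0F ×-dec v ≟ⱽ E 0 z) M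

  source∩sink : ∀ {v} → Source v → ¬ Sink v
  source∩sink (inj₁ (y , y<M , s1 , refl)) (inj₁ (y′ , z′ , r , t0 , e))
    with refl , refl ← E-injective {y} {0} {y′} {z′} e = <-irrefl (trans (sym (+-identityʳ y)) r) y<M
  source∩sink (inj₁ (y , y<M , s1 , refl)) (inj₂ (z′ , r , p1 , e))
    with refl , refl ← E-injective {y} {0} {0} {z′} e = 0≢1 (first-letter 1≤n σ) s1
  source∩sink (inj₂ (z , z<M , p0 , refl)) (inj₁ (y′ , z′ , r , t0 , e))
    with refl , refl ← E-injective {0} {z} {y′} {z′} e = <-irrefl r z<M
  source∩sink (inj₂ (z , z<M , p0 , refl)) (inj₂ (z′ , r , p1 , e))
    with refl , refl ← E-injective {0} {z} {0} {z′} e = 0≢1 p0 p1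

  record Degree≤ (d : ℕ) (v : Vertex) : Set where
    field
      nbrs   : List Vertex
      unique : Unique nbrs
      cover  : ∀ w → 1 ≤ G v w → w ∈ nbrs
      bound  : ∑ nbrs (G v) ≤ d

    at-most : ∀ us → Unique us → All (λ u → 1 ≤ G v u) us → length us ≤ d
    at-most us u h = ≤-trans (neighbours≤ v nbrs unique cover us u h) bound

  even-degree≤ : ∀ {d} y z → evenSum g y z ≤ d → Degree≤ d (E y z)
  even-degree≤ y z h = record
    { nbrs = evenNbrs y z ; unique = evenNbrs-unique y z ; cover = even-cover y z
    ; bound = ≤-trans (≤-reflexive (degree-even y z)) h }

  inside-degree≤ : ∀ {v} → InTriangle n v → Degree≤ 2 v
  inside-degree≤ {x , y} h with parity (proj₁ h)
  ... | z , inj₂ refl = record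
    { nbrs = oddNbrs y z ; unique = oddNbrs-unique y z ; cover = odd-cover y z
    ; bound = ≤-reflexive (degree-odd {y} {z} (O-outside {y} {z} h)) }
  ... | z , inj₁ refl with m≤n⇒m<n∨m≡n (E-outside {y} {z} h)
  ...   | inj₁ lt = even-degree≤ y z (degree-even≤2 {y} {z} lt)
  ...   | inj₂ eq = even-degree≤ y z (degree-right≤2 {y} {z} eq)

  end-degree≤ : ∀ {v} → Source v ⊎ Sink v → Degree≤ 1 v
  end-degree≤ (inj₁ (inj₁ (y , y<M , s1 , refl))) = even-degree≤ y 0 (≤-reflexive (degree-left-1 y<M s1))
  end-degree≤ (inj₁ (inj₂ (z , z<M , _ , refl)))  = even-degree≤ 0 z (degree-foot≤1 (<⇒≤ z<M))
  end-degree≤ (inj₂ (inj₁ (y , z , r , t0 , refl))) = even-degree≤ y z (degree-right-0 {y} {z} r t0)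
  end-degree≤ (inj₂ (inj₂ (z , z≤M , _ , refl)))  = even-degree≤ 0 z (degree-foot≤1 z≤M)

  degree≤2 : ∀ {v u w z} → 1 ≤ G v u → 1 ≤ G v w → u ≢ w → 1 ≤ G v z → z ≡ u ⊎ z ≡ w
  degree≤2 {v} {u} {w} {z} gu gw u≢w gz with z ≟ⱽ u | z ≟ⱽ w
  ... | yes z≡u | _       = inj₁ z≡u
  ... | no _    | yes z≡w = inj₂ z≡w
  ... | no z≢u  | no z≢w  = contradiction
    (Degree≤.at-most (inside-degree≤ (G-inside (subst (1 ≤_) (G-sym v u) gu))) (z ∷ u ∷ w ∷ [])
      ((z≢u ∷ z≢w ∷ []) ∷ (u≢w ∷ []) ∷ [] ∷ []) (gz ∷ gu ∷ gw ∷ []))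
    λ { (s≤s (s≤s ())) }

  degree≤1 : ∀ {v u w} → Source v ⊎ Sink v → 1 ≤ G v u → 1 ≤ G v w → u ≡ w
  degree≤1 {v} {u} {w} h gu gw with u ≟ⱽ w
  ... | yes u≡w = u≡w
  ... | no u≢w  = contradiction
    (Degree≤.at-most (end-degree≤ h) (u ∷ w ∷ []) ((u≢w ∷ []) ∷ [] ∷ []) (gu ∷ gw ∷ []))
    λ { (s≤s ()) }

  open PathFlow _≟ⱽ_ G G-sym Source Sink source∩sink degree≤2 degree≤1

  toPath : ∀ {v w} → Source v → Sink w → PathBetween f v w → Σ Path λ q → Path.first q ≡ v
  toPath s k ([] , q) with () ← IsPath.starts q
  toPath s k (v ∷ vs , q) with refl ← IsPath.starts q = record
    { first = v ; rest = vs ; source = s ; simple = IsPath.simple q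
    ; sink = subst Sink (sym (endOf-last v vs (IsPath.stops q))) k
    ; linked = Linked.map (λ a → let (e , e∈ , j) = find a in G-member e∈ j) (IsPath.linked q)
    } , refl

  path-from : ∀ {v} → Source v → Σ Path λ q → Path.first q ≡ v
  path-from S@(inj₁ (y , y<M , s1 , refl)) =
    let (i , e)        = index (<⇒≤ y<M)
        (j , t0 , q)   = L-paths i (trans (letter-nth σ i e) s1)
        (q′ , eq)      = toPath (subst Source (sym (L≡E i e)) S)
          (inj₁ (M ∸ toℕ j , toℕ j , R-row j , trans (sym (letter-nth τ j refl)) t0
                 , R≡E j refl (R-row j))) q
    in q′ , trans eq (L≡E i e)
  path-from S@(inj₂ (z , z<M , p0 , refl)) =
    let len = trans (length-word π) (sym suc-M)
        (z′ , m∈ , z<z′ , z′< , p1) = opens 0 [] (word π) (balanced π) z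
          (≤-trans (s≤s (<⇒≤ z<M)) (≤-reflexive (sym len))) p0
        z′≤M = ≤-pred (≤-trans z′< (≤-reflexive len))
        (i , e)   = index (<⇒≤ z<M)
        (j , e′)  = index z′≤M
        q = Equivalence.from (pairing i j (subst₂ _<_ (sym e) (sym e′) z<z′))
              (subst₂ (λ a b → (a , b) ∈ matching π) (sym e) (sym e′) m∈)
        (q′ , eq) = toPath (subst Source (sym (foot≡E i e)) S)
                      (inj₂ (z′ , z′≤M , p1 , foot≡E j e′)) q
    in q′ , trans eq (foot≡E i e)

  sources : List Vertex
  sources = filter source? (vertices n)

  collect : ∀ vs → All Source vs → Σ (List Path) λ ps → map Path.first ps ≡ vs
  collect []       []       = [] , refl
  collect (v ∷ vs) (h ∷ hs) =
    let (q , e) = path-from h ; (ps , es) = collect vs hs in q ∷ ps , cong₂ _∷_ e es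

  all-sources : All Source sources
  all-sources = All.tabulate λ v∈ → proj₂ (∈-filter⁻ source? {xs = vertices n} v∈)

  -- Exactly one path for each source, so the starts are distinct by construction.
  ps : List Path
  ps = proj₁ (collect sources all-sources)

  distinct : Unique (map Path.first ps)
  distinct = subst Unique (sym (proj₂ (collect sources all-sources)))
                   (Unique.filter⁺ source? vertices-unique)

  path∈ : ∀ {v} → InTriangle n v → Source v → v ∈ map Path.first ps
  path∈ h S = subst (_ ∈_) (sym (proj₂ (collect sources all-sources)))
                    (∈-filter⁺ source? (vertices-complete h) S)

  open PathSystem ps (AllPairs.map⁻ distinct)

  starts≥1 : ∀ {v} → InTriangle n v → Source v → 1 ≤ startCount v
  starts≥1 h S with ∈-map⁻ Path.first (path∈ h S)
  ... | q , q∈ , refl = starts-some q∈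

  notSink : ∀ {y z} → y + z < M → (y ≡ 0 → π̂ z ≡ 0F) → ¬ Sink (E y z)
  notSink {y} {z} h h0 (inj₁ (y′ , z′ , r , t0 , e))
    with refl , refl ← E-injective {y} {z} {y′} {z′} e = <-irrefl r h
  notSink {y} {z} h h0 (inj₂ (z′ , r , p1 , e))
    with refl , refl ← E-injective {y} {z} {0} {z′} e = 0≢1 (h0 refl) p1

  odd-notSink : ∀ {y z} → ¬ Sink (O y z)
  odd-notSink {y} {z} (inj₁ (y′ , z′ , _ , _ , e)) = E≢O {y′} {z′} {y} {z} (sym e)
  odd-notSink {y} {z} (inj₂ (z′ , _ , _ , e))      = E≢O {0} {z′} {y} {z} (sym e)

  odd-notSource : ∀ {y z} → ¬ Source (O y z)
  odd-notSource {y} {z} (inj₁ (y′ , _ , _ , e)) = E≢O {y′} {0} {y} {z} (sym e)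
  odd-notSource {y} {z} (inj₂ (z′ , _ , _ , e)) = E≢O {0} {z′} {y} {z} (sym e)

  -- The weights of a configuration

  b r : Weight
  b = fromEven W
  r = fromEven (λ v w → W w v)
  module b = Weight b
  module r = Weight r

  b-even-sum : ∀ y z → evenSum b y z + endCount (E y z) ≡ evenSum g y z + startCount (E y z)
  b-even-sum y z = subst₂ (λ x x′ → x + endCount (E y z) ≡ x′ + startCount (E y z))
    (sym (even-sum W y z)) (degree-even y z)
    (out-weight (E y z) (evenNbrs y z) (evenNbrs-unique y z) (even-cover y z))

  r-even-sum : ∀ y z → evenSum r y z + startCount (E y z) ≡ evenSum g y z + endCount (E y z)
  r-even-sum y z = subst₂ (λ x x′ → x + startCount (E y z) ≡ x′ + endCount (E y z))
    (sym (even-sum (λ v w → W w v) y z)) (degree-even y z)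
    (in-weight (E y z) (evenNbrs y z) (evenNbrs-unique y z) (even-cover y z))

  odd-starts : ∀ y z → startCount (O y z) ≡ 0
  odd-starts y z = starts-none (O y z) (odd-notSource {y} {z})

  odd-ends : ∀ y z → endCount (O y z) ≡ 0
  odd-ends y z = ends-none (O y z) (odd-notSink {y} {z})

  even-ends : ∀ {y z} → y + z < M → (y ≡ 0 → π̂ z ≡ 0F) → endCount (E y z) ≡ 0
  even-ends {y} {z} h h0 = ends-none (E y z) (notSink {y} {z} h h0)

  b-odd-sum : ∀ {y z} → y + z < M → oddSum b y z ≡ 2
  b-odd-sum {y} {z} h = begin
    oddSum b y z               ≡⟨ odd-sum W y z ⟩
    X                          ≡⟨ +-identityʳ X ⟨
    X + 0                      ≡⟨ cong (X +_) (odd-starts y z) ⟨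
    X + startCount (O y z)             ≡⟨ in-weight (O y z) (oddNbrs y z)
                                    (oddNbrs-unique y z) (odd-cover y z) ⟩
    ∑ (oddNbrs y z) (G (O y z)) + endCount (O y z) ≡⟨ cong₂ _+_ (degree-odd {y} {z} h) (odd-ends y z) ⟩
    2                          ∎
    where
    open ≡-Reasoning
    X = ∑ (oddNbrs y z) (λ w → W w (O y z))

  r-odd-sum : ∀ {y z} → y + z < M → oddSum r y z ≡ 2
  r-odd-sum {y} {z} h = begin
    oddSum r y z               ≡⟨ odd-sum (λ v w → W w v) y z ⟩
    X                          ≡⟨ +-identityʳ X ⟨
    X + 0                      ≡⟨ cong (X +_) (odd-ends y z) ⟨
    X + endCount (O y z)             ≡⟨ out-weight (O y z) (oddNbrs y z)
                                    (oddNbrs-unique y z) (odd-cover y z) ⟩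
    ∑ (oddNbrs y z) (G (O y z)) + startCount (O y z) ≡⟨ cong₂ _+_ (degree-odd {y} {z} h) (odd-starts y z) ⟩
    2                          ∎
    where
    open ≡-Reasoning
    X = ∑ (oddNbrs y z) (W (O y z))

  r-bound : ∀ {y z} → evenSum r y z ≤ evenSum g y z + endCount (E y z)
  r-bound {y} {z} = ≤-trans (m≤m+n _ _) (≤-reflexive (r-even-sum y z))

  -- A foot has degree 1 in the triangle, and at most one path ends there.
  r-even≤2 : ∀ y z → y + z < M → evenSum r y z ≤ 2
  r-even≤2 zero    z h = ≤-trans (r-bound {0} {z})
    (+-mono-≤ (≤-reflexive (degree-foot h)) (ends≤1 (E 0 z)))
  r-even≤2 (suc y) z h = ≤-trans (r-bound {suc y} {z})
    (+-mono-≤ (degree-even≤2 {suc y} {z} h) (≤-reflexive (even-ends {suc y} {z} h λ ())))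

  r-source : ∀ y z → y + z < M → (y ≡ 0 → π̂ z ≡ 0F) → evenSum g y z ≡ 1 →
             Source (E y z) → evenSum r y z ≡ 0
  r-source y z h h0 d S = n≤0⇒n≡0 (+-cancelʳ-≤ 1 _ _ (begin
    evenSum r y z + 1          ≤⟨ +-monoʳ-≤ (evenSum r y z) (starts≥1 (E-inside {y} {z} (<⇒≤ h)) S) ⟩
    evenSum r y z + startCount (E y z) ≡⟨ r-even-sum y z ⟩
    evenSum g y z + endCount (E y z) ≡⟨ cong₂ _+_ d (even-ends {y} {z} h h0) ⟩
    1                          ∎))
    where open ≤-Reasoning

  -- Where the degree is only 1, at opening feet and at left boundary vertices with letter 1, the
  -- path starting there contributes the second unit.
  b-even≥2 : ∀ y z → y + z < M → (y ≡ 0 → π̂ z ≡ 0F) → 2 ≤ evenSum b y z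
  b-even≥2 y z h h0 = begin
    2                          ≤⟨ available y z h h0 ⟩
    evenSum g y z + startCount (E y z) ≡⟨ b-even-sum y z ⟨
    evenSum b y z + endCount (E y z) ≡⟨ cong (evenSum b y z +_) (even-ends {y} {z} h h0) ⟩
    evenSum b y z + 0          ≡⟨ +-identityʳ _ ⟩
    evenSum b y z              ∎
    where
    open ≤-Reasoning
    available : ∀ y z → y + z < M → (y ≡ 0 → π̂ z ≡ 0F) → 2 ≤ evenSum g y z + startCount (E y z)
    available zero    z       h h0 = +-mono-≤ (≤-reflexive (sym (degree-foot h)))
      (starts≥1 (E-inside {0} {z} (<⇒≤ h)) (inj₂ (z , h , h0 refl , refl)))
    available (suc y) zero    h h0 with σ̂ (suc y) in eq
    ... | 0F = ≤-trans (≤-reflexive (sym (degree-left y<M eq))) (m≤m+n _ _)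
      where y<M = subst (_< M) (+-identityʳ (suc y)) h
    ... | 1F = +-mono-≤ (≤-reflexive (sym (degree-left-1 y<M eq)))
        (starts≥1 (E-inside {suc y} {0} (<⇒≤ h)) (inj₁ (suc y , y<M , eq , refl)))
      where y<M = subst (_< M) (+-identityʳ (suc y)) h
    available (suc y) (suc z) h h0 = ≤-trans (≤-reflexive (sym (degree-interior {y} {z} h))) (m≤m+n _ _)

  W-zero : ∀ {v w} → G v w ≡ 0 → W v w ≡ 0
  W-zero {v} {w} e = m+n≡0⇒m≡0 _ (trans (W+W v w) (cong (2 *_) e))

  -- At letter 1 both edges are present and no path ends, so two units of `b` leave the vertex; `a`
  -- and `d` would lead out of the triangle.
  b-right≥2 : ∀ y z → suc (suc (y + z)) ≡ M → τ̂ (suc z) ≡ 1F → 2 ≤ b.u y (suc z) + b.c (suc y) z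
  b-right≥2 y z h t1 = begin
    2
      ≤⟨ +-mono-≤ (Equivalence.from (right-u h′) t1) (right-c {suc y} h′) ⟩
    g.u y (suc z) + g.c (suc y) z
      ≡⟨ degree-right (suc y) (suc z) h′ ⟨
    evenSum g (suc y) (suc z)
      ≤⟨ m≤m+n _ _ ⟩
    evenSum g (suc y) (suc z) + startCount v
      ≡⟨ b-even-sum (suc y) (suc z) ⟨
    evenSum b (suc y) (suc z) + endCount v
      ≡⟨ cong (evenSum b (suc y) (suc z) +_) (ends-none v notSink′) ⟩
    evenSum b (suc y) (suc z) + 0
      ≡⟨ +-identityʳ _ ⟩
    evenSum b (suc y) (suc z)
      ≡⟨ cong₂ (λ a d → a + (b.u y (suc z) + (b.c (suc y) z + d)))
           (W-zero (right-a {suc y} h′)) (W-zero (right-d {suc y} h′)) ⟩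
    b.u y (suc z) + (b.c (suc y) z + 0)
      ≡⟨ cong (b.u y (suc z) +_) (+-identityʳ _) ⟩
    b.u y (suc z) + b.c (suc y) z ∎
    where
    open ≤-Reasoning
    v = E (suc y) (suc z)
    h′ : suc y + suc z ≡ M
    h′ = trans (cong suc (+-suc y z)) h
    notSink′ : ¬ Sink v
    notSink′ (inj₁ (y′ , z′ , _ , t0 , e))
      with refl , refl ← E-injective {suc y} {suc z} {y′} {z′} e = 0≢1 t0 t1
    notSink′ (inj₂ (z′ , _ , _ , e))
      with () ← cong proj₂ e

  ice : Ice M σ̂ τ̂ π̂
  ice = record
    { g = g ; r = r ; b = b
    ; g-c≤1   = λ _ _ → G≤1 _ _
    ; g-u≤1   = λ _ _ → G≤1 _ _
    ; r-c     = λ y z → ≤-trans (m≤m+n _ _) (≤-reflexive (trans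
                  (W+W (O y z) (E y (suc z))) (cong (2 *_) (G-sym _ _))))
    ; rb-u    = λ y z → ≤-trans (≤-reflexive (W+W (O y z) (E (suc y) z)))
                  (*-monoʳ-≤ 2 (G≤1 _ _))
    ; g-odd   = λ y z h → trans (odd-sum G y z)
                  (trans (∑-cong (oddNbrs y z) λ w → G-sym w (O y z)) (degree-odd {y} {z} h))
    ; g-even  = λ y z h → degree-even≤2 {y} {z} h
    ; g-foot  = λ z h → degree-foot≤1 (<⇒≤ h)
    ; g-left  = λ y h → left-a h
    ; g-right = λ y z h → Equivalence.to (right-u {y} h)
    ; r-odd   = λ y z h → ≤-reflexive (sym (r-odd-sum {y} {z} h))
    ; r-even  = r-even≤2
    ; r-foot  = λ z h p0 → r-source 0 z h (λ _ → p0) (degree-foot h) (inj₂ (z , h , p0 , refl))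
    ; r-left  = λ y h s1 → r-source y 0 (subst (_< M) (sym (+-identityʳ y)) h)
                  (λ _ → first-letter 1≤n π) (degree-left-1 h s1) (inj₁ (y , h , s1 , refl))
    ; b-odd   = λ y z h → ≤-reflexive (b-odd-sum {y} {z} h)
    ; b-even  = b-even≥2
    ; b-right = b-right≥2
    ; σ-first = first-letter 1≤n σ
    ; π-first = first-letter 1≤n π
    ; τ-first = first-letter 1≤n τ
    ; π-last  = last-letter suc-M π
    ; τ-last  = last-letter suc-M τ
    }

theorem4p6 : ∀ (n : ℕ) → 1 ≤ n → (π σ τ : 𝒟 n) →
    (u σ′ π′ v : Word) →
    word σ ≡ u ++ σ′ ++ v →
    word π ≡ u ++ π′ ++ v →
    (a b : ℕ) → a ≤ n → b ≤ n →
    n ∸ a ≡ ∣ u ∣₀ + ∣ v ∣₀ →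
    n ∸ b ≡ ∣ u ∣₁ + ∣ v ∣₁ →
    ¬ (∃[ τ′ ] word τ ≡ replicate (n ∸ a) 0F ++ τ′ ++ replicate (n ∸ b) 1F) →
    t σ τ π ≡ 0
theorem4p6 n 1≤n π σ τ u σ′ π′ v eσ eπ a b a≤n b≤n ea eb ¬τ′ =
  -- A single counted edge set would already give τ the excluded form.
  cong length (List.filter-none (isTFPL? σ τ π) {xs = sublists (edges n)} (All.tabulate λ f∈ T →
    ¬τ′ (common-parts (word σ) (word τ) (word π) (Configuration.ice 1≤n σ τ π _ f∈ T)
           (size σ) (size τ) (size π) balance u σ′ π′ v eσ eπ (n ∸ a) (n ∸ b) ea eb short)))
  where
  open Triangle n 1≤n
  size : (w : 𝒟 n) → length (word w) ≡ suc M
  size w = trans (length-word w) (sym suc-M)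
  n+n : n + n ≡ suc M
  n+n = trans (cong (n +_) (sym (+-identityʳ n))) (sym suc-M)
  balance : ∣ word π ∣₀ + ∣ word σ ∣₁ ≡ suc M
  balance = trans (cong₂ _+_ (𝒟.zeros π) (𝒟.ones σ)) n+n
  short : (n ∸ a) + (n ∸ b) ≤ suc M
  short = ≤-trans (+-mono-≤ (m∸n≤m n a) (m∸n≤m n b)) (≤-reflexive n+n)
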